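{- Let $\mathbf m=(m_1,m_2,\dots)$ be a type and $i\ge1$ an index with $m_i\neq0$ and $m_{i+1}\neq 0$. Let $v\in\mathcal W_n$ be a packed word of type $\vee_i\mathbf m$. Then $$\mathrm{sw}(v)\, e_{p_i(\mathbf m)}(x_1,\dots,x_n)=\sum_u \mathrm{sw}(u),$$ where the sum is over all words $u\in\mathcal W_n$ of type $\mathbf m$ such that $v=\vee_i u$.
   Context: Fix a positive integer $n$. Sites are elements of $\mathbb{Z}/n\mathbb{Z}$, identified with $1,\dots,n$, arranged cyclically. $\mathcal{W}_n$ is the set of words $u=u_1\cdots u_n$ with letters in $\{1,2,\dots\}$; $1^n$ is the all-$1$ word. The type of $u$ is $\mathbf m=(m_1,m_2,\dots)$ with $m_i$ the number of letters equal to $i$; $\ell=\max\{i:m_i\ne0\}$ is the number of classes; $u$ is packed if $m_i\neq 0$ for $1\le i\le\ell$. $p_i(\mathbf m)=m_1+\cdots+m_i$. The merge $\vee_i u$ is the word obtained from $u$ by decreasing every letter greater than $i$ by $1$; for types, $\vee_i\mathbf m=(m_1,\dots,m_{i-1},m_i+m_{i+1},m_{i+2},\dots)$. A queue is a subset $q\subseteq\{1,\dots,n\}$; an $r$-queue has size $r$. For a queue $q$ and $u\in\mathcal W_n$, $v=q(u)$ is defined by: choose a permutation $(i_1,\dots,i_n)$ of $(1,\dots,n)$ with $u_{i_1}\le\cdots\le u_{i_n}$; Phase I: for $i=i_n,\dots,i_{|q|+1}$ in this order, take the first site $j$ weakly to the left of $i$ (cyclically) with $j\notin q$ and $v_j$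 unset, and set $v_j=u_i+1$; Phase II: for $i=i_1,\dots,i_{|q|}$ in this order, take the first site $j$ weakly to the right of $i$ (cyclically) with $j\in q$ and $v_j$ unset, and set $v_j=u_i$. An (ordinary) MLQ of type $\mathbf m=(m_1,\dots,m_\ell,0,\dots)$ with $p_\ell(\mathbf m)=n$ is a sequence $\mathbf q=(q_1,\dots,q_{\ell-1})$ with $q_i$ a $p_i(\mathbf m)$-queue, acting by $\mathbf q(u)=q_{\ell-1}(\cdots q_1(u)\cdots)$. With indeterminates $x_1,\dots,x_n$, $\mathrm{wt}(\mathbf q)=\prod_{i}\prod_{j\in q_i}x_j$. For a packed word $u$ of type $\mathbf m$, the spectral weight is $\mathrm{sw}(u)=\sum\mathrm{wt}(\mathbf q)$ over all MLQs $\mathbf q$ of type $\mathbf m$ with $\mathbf q(1^n)=u$. $e_k$ denotes the elementary symmetric polynomial. -}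

module Defs where

open import Level using (Level)
open import Data.Nat using (ℕ; zero; suc; _∸_; _≤_; _⊔_; _<ᵇ_; _≡ᵇ_)
import Data.Nat as ℕ
open import Data.Nat.Properties using (suc-injective)
open import Data.Bool using (Bool; true; false; if_then_else_; not; _∧_)
open import Data.Maybe using (Maybe; just; nothing; is-nothing; fromMaybe)
open import Data.Fin using (Fin; zero; suc; fromℕ; inject₁; toℕ; lower₁)
open import Data.Fin.Subset using (Subset; ∣_∣)
open import Data.Vec using (Vec; []; _∷_; lookup; replicate; toList; _[_]≔_)
import Data.Vec as Vec
open import Data.Vec.Properties using (≡-dec)
open import Data.List using (List; []; _∷_; [_]; _++_; map; foldl; foldr; concatMap; reverse; take; drop; upTo; allFin)
open import Data.Nat.ListAction using (sum)
open import Data.Product using (∃; _×_)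
open import Relation.Nullary using (does; yes; no)
open import Relation.Binary.PropositionalEquality using (_≡_; _≢_; refl; cong)
open import Algebra.Bundles using (CommutativeSemiring)

-- A word u = u_1 ⋯ u_n (site j ↔ Fin n); letters are natural numbers,
-- and a word of 𝒲_n has all letters ≥ 1.
Word : ℕ → Set
Word n = Vec ℕ n

IsWord : ∀ {n} → Word n → Set
IsWord {n} u = (j : Fin n) → 1 ≤ lookup u j

count : ∀ {n} → ℕ → Word n → ℕ
count k u = sum (map (λ a → if a ≡ᵇ k then 1 else 0) (toList u))

-- A type 𝐦 = (m_1, m_2, …) is a function ℕ → ℕ; the value at 0 is unused.
Type : Set
Type = ℕ → ℕ

HasType : ∀ {n} → Word n → Type → Set
HasType u m = (k : ℕ) → 1 ≤ k → count k u ≡ m k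

typeOf : ∀ {n} → Word n → Type
typeOf u k = count k u

numClasses : ∀ {n} → Word n → ℕ
numClasses u = foldr _⊔_ 0 (toList u)

Packed : ∀ {n} → Word n → Set
Packed {n} u = IsWord u × ((j : Fin n) (k : ℕ) → 1 ≤ k → k ≤ lookup u j → ∃ λ (j' : Fin n) → lookup u j' ≡ k)

p : ℕ → Type → ℕ
p i m = sum (map (λ k → m (suc k)) (upTo i))

mergeWord : ∀ {n} → ℕ → Word n → Word n
mergeWord i u = Vec.map (λ a → if i <ᵇ a then a ∸ 1 else a) u

mergeType : ℕ → Type → Type
mergeType i m k = if k <ᵇ i then m k else (if k ≡ᵇ i then m i ℕ.+ m (suc i) else m (suc k))

cpred : ∀ {n} → Fin n → Fin n
cpred {suc k} zero    = fromℕ k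
cpred {suc k} (suc i) = inject₁ i

csucc : ∀ {n} → Fin n → Fin n
csucc {suc k} i with k ℕ.≟ toℕ i
... | yes _ = zero
... | no ne = lower₁ (suc i) (λ e → ne (suc-injective e))

findFrom : ∀ {n} → (Fin n → Fin n) → (Fin n → Bool) → ℕ → Fin n → Maybe (Fin n)
findFrom step ok zero    j = nothing
findFrom step ok (suc f) j = if ok j then just j else findFrom step ok f (step j)

insertSite : ∀ {n} → Word n → Fin n → List (Fin n) → List (Fin n)
insertSite u j []       = [ j ]
insertSite u j (k ∷ ks) = if lookup u j <ᵇ lookup u k then j ∷ k ∷ ks else k ∷ insertSite u j ks

-- the permutation (i_1, …, i_n) with u_{i_1} ≤ ⋯ ≤ u_{i_n}
-- (ties broken by increasing site index)
sortedSites : ∀ {n} → Word n → List (Fin n)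
sortedSites {n} u = foldl (λ acc j → insertSite u j acc) [] (allFin n)

isIn : ∀ {n} → Subset n → Fin n → Bool
isIn q j = lookup q j

placeAt : ∀ {n} → Vec (Maybe ℕ) n → Maybe (Fin n) → ℕ → Vec (Maybe ℕ) n
placeAt out nothing  a = out
placeAt out (just j) a = out [ j ]≔ just a

phaseI : ∀ {n} → Subset n → Word n → Vec (Maybe ℕ) n → Fin n → Vec (Maybe ℕ) n
phaseI {n} q u out i =
  placeAt out (findFrom cpred (λ j → not (isIn q j) ∧ is-nothing (lookup out j)) n i) (suc (lookup u i))

phaseII : ∀ {n} → Subset n → Word n → Vec (Maybe ℕ) n → Fin n → Vec (Maybe ℕ) n
phaseII {n} q u out i =
  placeAt out (findFrom csucc (λ j → isIn q j ∧ is-nothing (lookup out j)) n i) (lookup u i)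

applyQueue : ∀ {n} → Subset n → Word n → Word n
applyQueue {n} q u =
  let s   = sortedSites u
      o1  = foldl (phaseI q u) (replicate n nothing) (reverse (drop ∣ q ∣ s))
      o2  = foldl (phaseII q u) o1 (take ∣ q ∣ s)
  in Vec.map (fromMaybe 0) o2

allSubsets : ∀ n → List (Subset n)
allSubsets zero    = [ [] ]
allSubsets (suc n) = concatMap (λ s → (true ∷ s) ∷ (false ∷ s) ∷ []) (allSubsets n)

subsetsOfSize : ∀ n → ℕ → List (Subset n)
subsetsOfSize n k = Data.List.filter (λ s → ∣ s ∣ ℕ.≟ k) (allSubsets n)

mlqsOfSizes : ∀ n → List ℕ → List (List (Subset n))
mlqsOfSizes n []       = [ [] ]
mlqsOfSizes n (s ∷ ss) = concatMap (λ q → map (q ∷_) (mlqsOfSizes n ss)) (subsetsOfSize n s)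

mlqs : ∀ n → Type → ℕ → List (List (Subset n))
mlqs n m ℓ = mlqsOfSizes n (map (λ t → p (suc t) m) (upTo (ℓ ∸ 1)))

applyMLQ : ∀ {n} → List (Subset n) → Word n → Word n
applyMLQ qs u = foldl (λ w q → applyQueue q w) u qs

allOnes : ∀ n → Word n
allOnes n = replicate n 1

-- Polynomials in x_1 … x_n, represented by evaluation at an arbitrary
-- point x of an arbitrary commutative semiring.

module Poly {c ℓ : Level} (R : CommutativeSemiring c ℓ) where
  open CommutativeSemiring R using (Carrier; _+_; _*_; 0#; 1#)

  sumR : List Carrier → Carrier
  sumR = foldr _+_ 0#

  prodR : List Carrier → Carrier
  prodR = foldr _*_ 1#

  monQ : ∀ {n} → (Fin n → Carrier) → Subset n → Carrier
  monQ {n} x q = prodR (map (λ j → if isIn q j then x j else 1#) (allFin n))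

  wt : ∀ {n} → (Fin n → Carrier) → List (Subset n) → Carrier
  wt x qs = prodR (map (monQ x) qs)

  elem : ∀ {n} → (Fin n → Carrier) → ℕ → Carrier
  elem {n} x k = sumR (map (monQ x) (subsetsOfSize n k))

  sw : ∀ {n} → (Fin n → Carrier) → Word n → Carrier
  sw {n} x u =
    sumR (map (λ qs → if does (≡-dec ℕ._≟_ (applyMLQ qs (allOnes n)) u) then wt x qs else 0#)
              (mlqs n (typeOf u) (numClasses u)))

{-# OPTIONS --safe #-}

-- A word w is the flag of the subsets S k w = {j : w_j ≤ k}. A queue q sends S k w to the departures of
-- the single-server queue on the circle with arrivals S k w and services q, and adds q itself to the flag
-- as a new member; merging i and i+1 forgets the i-th member. Hence the right-hand side is the sum over
-- MLQs of type m of the words whose i-th member, which was created by q_i, has been forgotten.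
--
-- For two queues A, B with ∣A∣ ≤ ∣B∣, let D be the departures for arrivals A and services B, and let
-- R = A + B − D as multisets; R is again a set. Then (A, B) ↦ (D, R) is a weight-preserving bijection
-- (it is inverted by reversing time), and serving by A then B has the same departures as serving by R
-- then D. The latter is a Yang–Baxter equation; it follows from a local identity (a tetrahedron
-- equation) between the queue lengths at each site. By these interchanges q_i moves to the front of the
-- MLQ, where it acts on the word 1^n and only contributes the factor e_{p_i}.
module Submission where

open import Defs

-- Three obstacles shape the argument. `applyQueue` places letters one at a time by searching around
-- the circle, whereas the interchange speaks of queue lengths. They are connected by a length
-- function on the sites, kept up to date while the letters are placed: Phase II treats the letters
-- at most `k` before all larger ones, so the sites they occupy depend only on the set `S k w`. On
-- the circle a queue has no given initial length. The local identity must therefore carry periodic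
-- lengths to periodic lengths, and periodic lengths must exist, which is where `∣ A ∣ ≤ ∣ B ∣`
-- enters. The queues of an MLQ have weakly increasing sizes, so `q_i` is the larger partner in each
-- of its interchanges with an earlier queue. Finally, the words summed on the right are constrained
-- by their type. Any word produced by queues of sizes `p k m` has prescribed flag sizes, so of the
-- constraints on `u` only `mergeWord i u ≡ v` has to be imposed.

module Queues where

  open import Data.Nat
  open import Data.Nat.Properties
  open import Data.Bool using (Bool; true; false; not; _∧_; if_then_else_; T)
  open import Data.Bool.Properties using (∧-zeroʳ; ∧-identityʳ; T-≡)
  open import Data.Maybe using (Maybe; just; nothing; is-nothing; fromMaybe)
  open import Data.Maybe.Properties using (just-injective)
  open import Data.Fin as Fin using (Fin; zero; suc; toℕ; fromℕ; inject₁; lower₁)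
  open import Data.Fin.Properties using (toℕ-injective; toℕ-inject₁; toℕ-fromℕ; toℕ<n; lower₁-inject₁′; toℕ≤pred[n])
  open import Data.Fin.Subset using (Subset; ∣_∣; ∁; ⊤; ⊥)
  open import Data.Fin.Subset.Properties using (∣p∣≤n; ∣∁p∣≡n∸∣p∣; ∣⊥∣≡0)
  open import Data.Vec as Vec using (Vec; []; _∷_; lookup; tabulate; _[_]≔_; replicate; reverse; _∷ʳ_)
  open import Data.Vec.Properties using (lookup∘tabulate; lookup∘update; lookup∘update′; lookup-map; lookup-replicate; map-replicate; tabulate-cong; tabulate∘lookup; reverse-∷)
  open import Data.Vec.Functional using (updateAt)
  open import Data.Vec.Functional.Properties using (updateAt-updates; updateAt-minimal)
  open import Data.List as List using (List; []; _∷_; _++_; foldl; length; allFin; take; drop; upTo)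
  open import Data.List.Properties using (take++drop≡id; length-take; length-drop; length-reverse; length-tabulate; ++-identityʳ; upTo-∷ʳ; map-++)
  open import Data.List.Membership.Propositional using (_∈_)
  open import Data.List.Membership.Propositional.Properties using (∈-allFin; ∈-++⁻)
  open import Data.List.Relation.Unary.All as All using (All; []; _∷_)
  import Data.List.Relation.Unary.All.Properties as All
  open import Data.List.Relation.Unary.Any using (here; there)
  open import Data.List.Relation.Unary.AllPairs as AllPairs using (AllPairs; []; _∷_)
  import Data.List.Relation.Unary.AllPairs.Properties as AllPairs
  open import Data.List.Relation.Unary.Unique.Propositional using (Unique)
  open import Data.List.Relation.Unary.Unique.Propositional.Properties using (allFin⁺)
  open import Data.List.Relation.Binary.Permutation.Propositional using (_↭_; ↭-refl; ↭-sym; ↭-trans; ↭-prep; ↭-swap; ↭-reflexive; ↭⇒↭ₛ)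
  open import Data.List.Relation.Binary.Permutation.Propositional.Properties using (All-resp-↭; ∈-resp-↭; ↭-length; ↭-reverse; shift; ++⁺ˡ)
  open import Data.Nat.ListAction using (sum)
  open import Data.Nat.ListAction.Properties using (sum-++)
  open import Data.Product
  open import Data.Sum using (_⊎_; inj₁; inj₂)
  open import Function using (_∘_; const; _⇔_; mk⇔; Equivalence)
  open import Relation.Binary.Definitions using (tri<; tri≈; tri>)
  open import Relation.Binary.PropositionalEquality
  open import Relation.Nullary using (yes; no; contradiction)

  -- The single-server queue on a line and on the circle

  variable
    n x y z w x' y' w' W Z₁ Z₂ W' Z₁' Z₂' i k : ℕ
    a b d r s u d' r' : Bool
    A B C D E R D' R' : Subset n

  -- Step x a b y d r: with x customers waiting, arrival a and service b give the departure d and leave y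
  -- customers waiting; r is the remainder of the site, a + b = d + r.
  data Step : ℕ → Bool → Bool → ℕ → Bool → Bool → Set where
    idle   : Step x       false false x       false false
    wait   : Step x       true  false (suc x) false true
    unused : Step 0       false true  0       false true
    serve  : Step (suc x) false true  x       true  false
    pass   : Step x       true  true  x       true  true

  data Run : ℕ → Subset n → Subset n → ℕ → Subset n → Subset n → Set where
    []  : Run x [] [] x [] []
    _∷_ : Step x a b y d r → Run y A B z D R → Run x (a ∷ A) (b ∷ B) z (d ∷ D) (r ∷ R)

  Queue : Subset n → Subset n → Subset n → Subset n → Set
  Queue A B D R = ∃ λ x → Run x A B x D R

  step : ∀ x a b → ∃ λ y → ∃ λ d → ∃ λ r → Step x a b y d r
  step x       false false = _ , _ , _ , idle
  step x       true  false = _ , _ , _ , wait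
  step zero    false true  = _ , _ , _ , unused
  step (suc x) false true  = _ , _ , _ , serve
  step x       true  true  = _ , _ , _ , pass

  run : ∀ x (A B : Subset n) → ∃ λ y → ∃ λ D → ∃ λ R → Run x A B y D R
  run x []      []      = _ , _ , _ , []
  run x (a ∷ A) (b ∷ B) with _ , _ , _ , s ← step x a b with _ , _ , _ , t ← run _ A B = _ , _ , _ , s ∷ t

  step-gap : Step x a b y d r → Step (i + x) a b y' d' r' →
    ∃ λ k → y' ≡ k + y × k ≤ i × (k ≡ i → d ≡ d' × r ≡ r')
  step-gap {i = i} idle idle = i , refl , ≤-refl , λ _ → refl , refl
  step-gap {i = i} wait wait = i , sym (+-suc i _) , ≤-refl , λ _ → refl , refl
  step-gap {i = i} pass pass = i , refl , ≤-refl , λ _ → refl , refl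
  step-gap {i = zero} unused unused = 0 , refl , z≤n , λ _ → refl , refl
  step-gap {i = suc i} unused serve = i , refl , n≤1+n i , λ ()
  step-gap {i = zero} serve serve = 0 , refl , z≤n , λ _ → refl , refl
  step-gap {x = suc x} {i = suc i} serve serve = suc i , +-suc i x , ≤-refl , λ _ → refl , refl

  run-gap : Run x A B y D R → Run (i + x) A B y' D' R' →
    ∃ λ k → y' ≡ k + y × k ≤ i × (k ≡ i → D ≡ D' × R ≡ R')
  run-gap [] [] = _ , refl , ≤-refl , λ _ → refl , refl
  run-gap {i = i} (s ∷ t) (s' ∷ t') with step-gap s s'
  ... | k , refl , k≤i , e with run-gap t t'
  ... | l , y'≡ , l≤k , e' = l , y'≡ , ≤-trans l≤k k≤i , λ l≡i →
    let k≡i = ≤-antisym k≤i (subst (_≤ k) l≡i l≤k)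
        l≡k = trans l≡i (sym k≡i)
    in cong₂ _∷_ (proj₁ (e k≡i)) (proj₁ (e' l≡k)) , cong₂ _∷_ (proj₂ (e k≡i)) (proj₂ (e' l≡k))

  -- Both runs return to their initial lengths, so the gap is the same after the round as before it.
  -- As it can never grow, it never shrank, and then the outputs agree.
  Queue-functional-≤ : x ≤ w → Run x A B x D R → Run w A B w D' R' → D ≡ D' × R ≡ R'
  Queue-functional-≤ {x = x} {A = A} {B = B} {D' = D'} {R' = R'} x≤w t t' with o , refl ← m≤n⇒∃[o]m+o≡n x≤w
    with k , e , _ , f ← run-gap t (subst (λ e → Run e A B e D' R') (+-comm x o) t')
    = f (sym (+-cancelʳ-≡ x _ _ e))

  Queue-functional : Queue A B D R → Queue A B D' R' → D ≡ D' × R ≡ R'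
  Queue-functional (x , t) (x' , t') with ≤-total x x'
  ... | inj₁ x≤x' = Queue-functional-≤ x≤x' t t'
  ... | inj₂ x'≤x = map sym sym (Queue-functional-≤ x'≤x t' t)

  Run-det : Run x A B y D R → Run x A B y' D' R' → y ≡ y'
  Run-det t t' with run-gap {i = 0} t t'
  ... | .0 , e , z≤n , _ = sym e

  run-coupled : x ≤ w → Run x A B y D R → Run w A B z D' R' → y ≡ z ⊎ z + ∣ B ∣ ≡ w + ∣ A ∣
  run-coupled x≤w [] [] = inj₂ refl
  run-coupled x≤w (idle ∷ t) (idle ∷ t') = run-coupled x≤w t t'
  run-coupled {w = w} x≤w (wait ∷ t) (wait ∷ t') with run-coupled (s≤s x≤w) t t'
  ... | inj₁ e = inj₁ e
  ... | inj₂ e = inj₂ (trans e (sym (+-suc w _)))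
  run-coupled x≤w (unused ∷ t) (unused ∷ t') = inj₁ (Run-det t t')
  run-coupled z≤n (unused ∷ t) (serve ∷ t') with run-coupled z≤n t t'
  ... | inj₁ e = inj₁ e
  ... | inj₂ e = inj₂ (trans (+-suc _ _) (cong suc e))
  run-coupled (s≤s x≤w) (serve ∷ t) (serve ∷ t') with run-coupled x≤w t t'
  ... | inj₁ e = inj₁ e
  ... | inj₂ e = inj₂ (trans (+-suc _ _) (cong suc e))
  run-coupled x≤w (pass ∷ t) (pass ∷ t') with run-coupled x≤w t t'
  ... | inj₁ e = inj₁ e
  ... | inj₂ e = inj₂ (trans (+-suc _ _) (trans (cong suc e) (sym (+-suc _ _))))

  -- One round from the empty queue already reaches the periodic regime.
  cyc : Subset n × Subset n → Subset n × Subset n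
  cyc (A , B) with c , _ ← run 0 A B with _ , D , R , _ ← run c A B = D , R

  queue : (A B : Subset n) → ∣ A ∣ ≤ ∣ B ∣ → Queue A B (proj₁ (cyc (A , B))) (proj₂ (cyc (A , B)))
  queue A B A≤B with run 0 A B
  ... | c , _ , _ , t with run c A B
  ... | c' , D , R , t' = c , subst (λ e → Run c A B e D R) c'≡c t'
    where
    c'≡c : c' ≡ c
    c'≡c with run-coupled z≤n t t' | run-gap t (subst (λ e → Run e A B c' D R) (sym (+-identityʳ c)) t')
    ... | inj₁ e | _ = sym e
    -- The balance and `∣ A ∣ ≤ ∣ B ∣` bound the length after the second round by `c`; starting at
    -- `c` instead of `0` cannot lower the final length, which gives the other bound.
    ... | inj₂ e | k , refl , _ = ≤-antisym
        (+-cancelʳ-≤ ∣ B ∣ _ _ (≤-trans (≤-reflexive e) (+-monoʳ-≤ c A≤B)))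
        (m≤n+m c k)

  run-served : Run x A B y D R → y + ∣ D ∣ ≡ x + ∣ A ∣
  run-served [] = refl
  run-served (idle ∷ t) = run-served t
  run-served {x = x} (wait ∷ t) = trans (run-served t) (sym (+-suc x _))
  run-served (unused ∷ t) = run-served t
  run-served (serve ∷ t) = trans (+-suc _ _) (cong suc (run-served t))
  run-served (pass ∷ t) = trans (+-suc _ _) (trans (cong suc (run-served t)) (sym (+-suc _ _)))

  run-residue : Run x A B y D R → x + ∣ R ∣ ≡ y + ∣ B ∣
  run-residue [] = refl
  run-residue (idle ∷ t) = run-residue t
  run-residue (wait ∷ t) = trans (+-suc _ _) (run-residue t)
  run-residue (unused ∷ t) = trans (cong suc (run-residue t)) (sym (+-suc _ _))
  run-residue (serve ∷ t) = trans (cong suc (run-residue t)) (sym (+-suc _ _))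
  run-residue (pass ∷ t) = trans (+-suc _ _) (trans (cong suc (run-residue t)) (sym (+-suc _ _)))

  queue-served : Queue A B D R → ∣ D ∣ ≡ ∣ A ∣
  queue-served (x , t) = +-cancelˡ-≡ x _ _ (run-served t)

  queue-residue : Queue A B D R → ∣ R ∣ ≡ ∣ B ∣
  queue-residue (x , t) = +-cancelˡ-≡ x _ _ (run-residue t)

  -- Read backwards, `wait` and `serve` trade places and the other cases are fixed. The remainders
  -- are defined so that `(d, r)` can take over the roles of arrival and service.
  step-reverse : Step x a b y d r → Step y d r x a b
  step-reverse idle = idle
  step-reverse wait = serve
  step-reverse unused = unused
  step-reverse serve = wait
  step-reverse pass = pass

  run-∷ʳ : Run x A B y D R → Step y a b z d r → Run x (A ∷ʳ a) (B ∷ʳ b) z (D ∷ʳ d) (R ∷ʳ r)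
  run-∷ʳ [] s = s ∷ []
  run-∷ʳ (s ∷ t) s' = s ∷ run-∷ʳ t s'

  run-reverse : Run x A B y D R → Run y (reverse D) (reverse R) x (reverse A) (reverse B)
  run-reverse [] = []
  run-reverse (_∷_ {a = a} {b = b} {d = d} {r = r} {A = A} {B = B} {D = D} {R = R} s t)
    rewrite reverse-∷ a A | reverse-∷ b B | reverse-∷ d D | reverse-∷ r R
    = run-∷ʳ (run-reverse t) (step-reverse s)

  -- The tetrahedron equation and the interchange of two servers

  -- The combinatorial 3D R, (x, y, w) ↦ (y + (w ∸ x), x ⊓ w, y + (x ∸ w)). Here x and y are the queue
  -- lengths at A and B in tandem and w that of their remainders; the image consists of the queue length
  -- of the pair (A, B) and of those at the two interchanged servers.
  data Tri : (x y w W Z₁ Z₂ : ℕ) → Set where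
    same : Tri z y z y z y
    more : ∀ i → Tri (suc (i + z)) y z y z (suc (i + y))
    less : ∀ k → Tri z y (suc (k + z)) (suc (k + y)) z y

  moreBy : ∀ i → x ≡ i + z → Z₂ ≡ i + y → Tri x y z y z Z₂
  moreBy zero    refl refl = same
  moreBy (suc i) refl refl = more i

  lessBy : ∀ k → w ≡ k + z → W ≡ k + y → Tri z y w W z y
  lessBy zero    refl refl = same
  lessBy (suc k) refl refl = less k

  -- `Tri` is a relation so that `tetra` can match on how `x` compares with `w`. The closed form
  -- shows that it is the graph of a function, and this is what transports periodicity.
  Tri-formula : Tri x y w W Z₁ Z₂ → W ≡ (w ∸ x) + y × Z₁ ≡ x ⊓ w × Z₂ ≡ (x ∸ w) + y
  Tri-formula {x = x} {y = y} same rewrite n∸n≡0 x = refl , sym (⊓-idem x) , refl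
  Tri-formula {y = y} (more {z} i) rewrite m+n∸n≡m (suc i) z =
    cong (_+ y) (sym (m≤n⇒m∸n≡0 (m≤n+m z (suc i)))) , sym (m≥n⇒m⊓n≡n (m≤n+m z (suc i))) , refl
  Tri-formula {y = y} (less {z} k) rewrite m+n∸n≡m (suc k) z =
    refl , sym (m≤n⇒m⊓n≡m (m≤n+m z (suc k))) , cong (_+ y) (sym (m≤n⇒m∸n≡0 (m≤n+m z (suc k))))

  Tri-functional : Tri x y w W Z₁ Z₂ → Tri x y w W' Z₁' Z₂' → W ≡ W' × Z₁ ≡ Z₁' × Z₂ ≡ Z₂'
  Tri-functional s t with refl , refl , refl ← Tri-formula s | refl , refl , refl ← Tri-formula t = refl , refl , refl

  tri : ∀ x y w → ∃ λ W → ∃ λ Z₁ → ∃ λ Z₂ → Tri x y w W Z₁ Z₂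
  tri x y w with ≤-total w x
  ... | inj₁ w≤x = _ , _ , _ , moreBy (x ∸ w) (sym (m∸n+n≡m w≤x)) refl
  ... | inj₂ x≤w = _ , _ , _ , lessBy (w ∸ x) (sym (m∸n+n≡m x≤w)) refl

  -- The opposite order at one site: `a` meets `b` at length `W`, then `u` is served by the
  -- remainder `r₀` at length `Z₁`, and its departure `c₀` by `d₀` at length `Z₂`. The last
  -- departure has to be the same `d`.
  record Tetra (x' y' w' : ℕ) (u a b d : Bool) (W Z₁ Z₂ : ℕ) : Set where
    constructor tet
    field
      {V Y₁ Y₂}       : ℕ
      {d₀ r₀ c₀ h₁ h₂} : Bool
      image           : Tri x' y' w' V Y₁ Y₂
      step₀           : Step W a b V d₀ r₀
      step₁           : Step Z₁ u r₀ Y₁ c₀ h₁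
      step₂           : Step Z₂ c₀ d₀ Y₂ d h₂

  -- A finite check: a site changes each length by at most one and only tests it for zero, so the
  -- emptiness of the queues and the comparison of `x` with `w` decide everything. `moreBy` and
  -- `lessBy` absorb the cases where the difference of `x` and `w` may reach zero.
  tetra : ∀ {e f c} → Tri x y w W Z₁ Z₂ →
    Step x u a x' c r → Step y c b y' d s → Step w r s w' e f → Tetra x' y' w' u a b d W Z₁ Z₂
  tetra t idle idle idle = tet t idle idle idle
  tetra same idle unused unused = tet same unused unused idle
  tetra (more i) idle unused unused = tet (more i) unused unused idle
  tetra same idle unused serve = tet (more 0) unused serve wait
  tetra (more {suc z} i) idle unused serve = tet (moreBy (2 + i) (cong suc (+-suc i z)) refl) unused serve wait
  tetra (less k) idle unused serve = tet (lessBy k refl refl) serve idle unused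
  tetra same idle serve idle = tet same serve idle serve
  tetra (more {y = suc y} i) idle serve idle = tet (moreBy (suc i) refl (+-suc i y)) serve idle serve
  tetra (less {y = suc y} k) idle serve idle = tet (lessBy (suc k) refl (+-suc k y)) serve idle serve
  tetra same wait idle wait = tet same idle wait idle
  tetra (more {z} i) wait idle wait = tet (moreBy (suc i) (cong suc (sym (+-suc i z))) refl) idle wait idle
  tetra (less {z} k) wait idle wait = tet (lessBy (suc k) (cong suc (sym (+-suc k z))) refl) idle wait idle
  tetra same wait unused pass = tet (more 0) unused pass wait
  tetra (more i) wait unused pass = tet (more (suc i)) unused pass wait
  tetra (less {z} k) wait unused pass = tet (lessBy k (sym (+-suc k z)) refl) serve wait unused
  tetra same wait serve wait = tet same serve wait serve
  tetra (more {z} {suc y} i) wait serve wait = tet (moreBy (suc i) (cong suc (sym (+-suc i z))) (+-suc i y)) serve wait serve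
  tetra (less {z} {suc y} k) wait serve wait = tet (lessBy (suc k) (cong suc (sym (+-suc k z))) (+-suc k y)) serve wait serve
  tetra same unused idle wait = tet (less 0) wait unused idle
  tetra (less k) unused idle wait = tet (less (suc k)) wait unused idle
  tetra same unused unused pass = tet same pass unused unused
  tetra (less k) unused unused pass = tet (less k) pass unused unused
  tetra same unused serve wait = tet (less 0) pass unused serve
  tetra (less {y = suc y} k) unused serve wait = tet (lessBy (2 + k) refl (cong suc (+-suc k y))) pass unused serve
  tetra (more {y = y} i) serve wait unused = tet (moreBy i refl (sym (+-suc i y))) wait unused idle
  tetra same serve wait serve = tet same wait serve wait
  tetra (more {suc z} {y} i) serve wait serve = tet (moreBy (suc i) (+-suc i z) (cong suc (sym (+-suc i y)))) wait serve wait
  tetra (less {suc z} {y} k) serve wait serve = tet (lessBy (suc k) (+-suc k z) (cong suc (sym (+-suc k y)))) wait serve wait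
  tetra (more i) serve pass unused = tet (moreBy i refl refl) pass unused serve
  tetra same serve pass serve = tet same pass serve pass
  tetra (more {suc z} i) serve pass serve = tet (moreBy (suc i) (+-suc i z) refl) pass serve pass
  tetra (less {suc z} k) serve pass serve = tet (lessBy (suc k) (+-suc k z) refl) pass serve pass
  tetra same pass wait pass = tet same wait pass wait
  tetra (more {y = y} i) pass wait pass = tet (moreBy (suc i) refl (cong suc (sym (+-suc i y)))) wait pass wait
  tetra (less {y = y} k) pass wait pass = tet (lessBy (suc k) refl (cong suc (sym (+-suc k y)))) wait pass wait
  tetra t pass pass pass = tet t pass pass pass

  record TetraRun (x' y' w' : ℕ) (U A B D : Subset n) (W Z₁ Z₂ : ℕ) : Set where
    field
      {V Y₁ Y₂}       : ℕ
      {D₀ R₀ C₀ H₁ H₂} : Subset n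
      image           : Tri x' y' w' V Y₁ Y₂
      run₀            : Run W A B V D₀ R₀
      run₁            : Run Z₁ U R₀ Y₁ C₀ H₁
      run₂            : Run Z₂ C₀ D₀ Y₂ D H₂

  tetra-run : ∀ {U F S : Subset n} → Tri x y w W Z₁ Z₂ →
    Run x U A x' C R → Run y C B y' D S → Run w R S w' E F → TetraRun x' y' w' U A B D W Z₁ Z₂
  tetra-run t [] [] [] = record { image = t ; run₀ = [] ; run₁ = [] ; run₂ = [] }
  tetra-run t (s₁ ∷ t₁) (s₂ ∷ t₂) (s₃ ∷ t₃)
    with tet t' s₀ s₁' s₂' ← tetra t s₁ s₂ s₃
    with record { image = t'' ; run₀ = r₀ ; run₁ = r₁ ; run₂ = r₂ } ← tetra-run t' t₁ t₂ t₃
    = record { image = t'' ; run₀ = s₀ ∷ r₀ ; run₁ = s₁' ∷ r₁ ; run₂ = s₂' ∷ r₂ }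

  -- The remainders of the two servers have sizes `∣ A ∣` and `∣ B ∣`, so the auxiliary queue
  -- between them has a periodic length `w`. Then `(x, y, w)` is the same at both ends of the round
  -- and, `Tri` being functional, so is its image. The three runs in the opposite order are thus
  -- periodic, and `Queue-functional` identifies them with the given queues.
  interchange : ∀ {U P Q C' D' H₁ H₂ S : Subset n} → ∣ A ∣ ≤ ∣ B ∣ →
    Queue U A C R → Queue C B D S →
    Queue A B P Q → Queue U Q C' H₁ → Queue C' P D' H₂ → D ≡ D'
  interchange A≤B (x , t₁) (y , t₂) q₀ q₁ q₂
    with w , t₃ ← queue _ _ (subst₂ _≤_ (sym (queue-residue (x , t₁))) (sym (queue-residue (y , t₂))) A≤B)
    with _ , _ , _ , t ← tri x y w
    with record { image = t' ; run₀ = r₀ ; run₁ = r₁ ; run₂ = r₂ } ← tetra-run t t₁ t₂ t₃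
    with refl , refl , refl ← Tri-functional t t'
    with refl , refl ← Queue-functional q₀ (_ , r₀)
    with refl , _ ← Queue-functional q₁ (_ , r₁)
    = proj₁ (Queue-functional (_ , r₂) q₂)

  -- Sites on the circle

  csucc-inject₁ : (i : Fin n) → csucc (inject₁ i) ≡ suc i
  csucc-inject₁ {suc n} i with suc n ≟ toℕ (inject₁ i)
  ... | yes e = contradiction (trans e (toℕ-inject₁ i)) (>⇒≢ (toℕ<n i))
  ... | no ne = cong suc (lower₁-inject₁′ i _)

  csucc-fromℕ : ∀ n → csucc (fromℕ n) ≡ zero
  csucc-fromℕ n with n ≟ toℕ (fromℕ n)
  ... | yes _ = refl
  ... | no ne = contradiction (sym (toℕ-fromℕ n)) ne

  data InitLast : ∀ {n} → Fin (suc n) → Set where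
    init : (i : Fin n) → InitLast (inject₁ i)
    last : InitLast (fromℕ n)

  initLast : (i : Fin (suc n)) → InitLast i
  initLast {zero} zero = last
  initLast {suc n} zero = init zero
  initLast {suc n} (suc i) with initLast i
  ... | init j = init (suc j)
  ... | last = last

  cpred-csucc : (j : Fin n) → cpred (csucc j) ≡ j
  cpred-csucc {suc n} j with initLast j
  ... | init i rewrite csucc-inject₁ i = refl
  ... | last rewrite csucc-fromℕ n = refl

  csucc-injective : {i j : Fin n} → csucc i ≡ csucc j → i ≡ j
  csucc-injective {i = i} {j} e = trans (sym (cpred-csucc i)) (trans (cong cpred e) (cpred-csucc j))

  iter : ∀ {A : Set} → (A → A) → ℕ → A → A
  iter f zero    i = i
  iter f (suc t) i = iter f t (f i)

  iter-+ : ∀ {A : Set} (f : A → A) t {s} i → iter f (t + s) i ≡ iter f s (iter f t i)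
  iter-+ f zero    i = refl
  iter-+ f (suc t) i = iter-+ f t (f i)

  iter-comm : ∀ {A : Set} (f : A → A) t i → iter f t (f i) ≡ f (iter f t i)
  iter-comm f zero    i = refl
  iter-comm f (suc t) i = iter-comm f t (f i)

  csucc-up : ∀ t (i j : Fin n) → t + toℕ i ≡ toℕ j → iter csucc t i ≡ j
  csucc-up zero i j e = toℕ-injective e
  csucc-up {suc n} (suc t) i j e with initLast i
  ... | init i' rewrite csucc-inject₁ i' =
    csucc-up t (suc i') j (trans (+-suc t _) (trans (cong (λ e → suc (t + e)) (sym (toℕ-inject₁ i'))) e))
  ... | last = contradiction (toℕ≤pred[n] j)
    (<⇒≱ (subst (n <_) e (s≤s (≤-trans (≤-reflexive (sym (toℕ-fromℕ n))) (m≤n+m _ t)))))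

  Covering : (Fin n → Fin n) → Set
  Covering {n} f = ∀ i j → ∃ λ t → t < n × iter f t i ≡ j

  csucc-covering : Covering {n} csucc
  csucc-covering {suc n} i j with toℕ i ≤? toℕ j
  ... | yes i≤j = toℕ j ∸ toℕ i , ≤-<-trans (m∸n≤m (toℕ j) (toℕ i)) (toℕ<n j) , csucc-up _ i j (m∸n+n≡m i≤j)
  ... | no i≰j = (n ∸ toℕ i) + suc (toℕ j) , lt , (begin
      iter csucc ((n ∸ toℕ i) + suc (toℕ j)) i            ≡⟨ iter-+ csucc (n ∸ toℕ i) i ⟩
      iter csucc (suc (toℕ j)) (iter csucc (n ∸ toℕ i) i)
        ≡⟨ cong (iter csucc (suc (toℕ j))) (csucc-up (n ∸ toℕ i) i (fromℕ n) (trans (m∸n+n≡m (toℕ≤pred[n] i)) (sym (toℕ-fromℕ n)))) ⟩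
      iter csucc (toℕ j) (csucc (fromℕ n))               ≡⟨ cong (iter csucc (toℕ j)) (csucc-fromℕ n) ⟩
      iter csucc (toℕ j) zero                            ≡⟨ csucc-up (toℕ j) zero j (+-identityʳ _) ⟩
      j                                                  ∎)
    where
    open ≡-Reasoning
    lt : (n ∸ toℕ i) + suc (toℕ j) < suc n
    lt = s≤s (≤-trans (+-monoʳ-≤ (n ∸ toℕ i) (≰⇒> i≰j)) (≤-reflexive (m∸n+n≡m (toℕ≤pred[n] i))))

  cpred-covering : Covering {n} cpred
  cpred-covering i j with t , t<n , e ← csucc-covering j i = t , t<n , back t j i e
    where
    back : ∀ t j i → iter csucc t j ≡ i → iter cpred t i ≡ j
    back zero j i e = sym e
    back (suc t) j i e = trans (iter-comm cpred t i) (trans (cong cpred (back t (csucc j) i e)) (cpred-csucc j))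

  -- Greedy placement into vacant sites

  findFrom-ok : (f : Fin n → Fin n) (ok : Fin n → Bool) → ∀ m t i → t < m → ok (iter f t i) ≡ true →
    ∃ λ j → findFrom f ok m i ≡ just j × ok j ≡ true
  findFrom-ok f ok (suc m) t i t<m e with ok i in oki
  ... | true = i , refl , oki
  findFrom-ok f ok (suc m) zero i t<m e | false with () ← trans (sym oki) e
  findFrom-ok f ok (suc m) (suc t) i (s≤s t<m) e | false = findFrom-ok f ok m t (f i) t<m e

  ∣∣-remove : (p : Subset n) (j : Fin n) → lookup p j ≡ true → suc ∣ p [ j ]≔ false ∣ ≡ ∣ p ∣
  ∣∣-remove (true ∷ p) zero refl = refl
  ∣∣-remove (true ∷ p) (suc j) e = cong suc (∣∣-remove p j e)
  ∣∣-remove (false ∷ p) (suc j) e = ∣∣-remove p j e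

  ∣∣-nonempty : (p : Subset n) → 1 ≤ ∣ p ∣ → ∃ λ j → lookup p j ≡ true
  ∣∣-nonempty (true ∷ p) _ = zero , refl
  ∣∣-nonempty (false ∷ p) 1≤ with j , e ← ∣∣-nonempty p 1≤ = suc j , e

  ∣∣-empty : (p : Subset n) → ∣ p ∣ ≡ 0 → ∀ j → lookup p j ≡ false
  ∣∣-empty (false ∷ p) e zero = refl
  ∣∣-empty (false ∷ p) e (suc j) = ∣∣-empty p e j

  lookup-ext : ∀ {A : Set} {xs ys : Vec A n} → (∀ j → lookup xs j ≡ lookup ys j) → xs ≡ ys
  lookup-ext {xs = xs} {ys} e = trans (sym (tabulate∘lookup xs)) (trans (tabulate-cong e) (tabulate∘lookup ys))

  ∧-split : ∀ {a b} → a ∧ b ≡ true → a ≡ true × b ≡ true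
  ∧-split {true} {true} refl = refl , refl

  is-nothing-true : {o : Maybe ℕ} → is-nothing o ≡ true → o ≡ nothing
  is-nothing-true {nothing} _ = refl

  -- Phases I and II are the same process with different directions, admissible sites and letters.
  -- As long as a vacancy remains, `covering` makes the search succeed within `n` steps, so the
  -- `nothing` case of `placeAt` does not arise.
  module Place {n} (f : Fin n → Fin n) (covering : Covering f) (P : Fin n → Bool) (val : Fin n → ℕ) where

    Out : Set
    Out = Vec (Maybe ℕ) n

    ok : Out → Fin n → Bool
    ok out j = P j ∧ is-nothing (lookup out j)

    put : Out → Fin n → Out
    put out i = placeAt out (findFrom f (ok out) n i) (val i)

    vacant : Out → Subset n
    vacant out = tabulate (ok out)

    put-spec : ∀ out i → 1 ≤ ∣ vacant out ∣ → ∃ λ j →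
      findFrom f (ok out) n i ≡ just j × P j ≡ true × lookup out j ≡ nothing ×
      put out i ≡ out [ j ]≔ just (val i) × suc ∣ vacant (put out i) ∣ ≡ ∣ vacant out ∣
    put-spec out i 1≤
      with j₀ , e₀ ← ∣∣-nonempty (vacant out) 1≤
      with t , t<n , refl ← covering i j₀
      with j , found , okj ← findFrom-ok f (ok out) n t i t<n (trans (sym (lookup∘tabulate (ok out) (iter f t i))) e₀)
      with Pj , nj ← ∧-split {P j} okj
      rewrite found
      = j , refl , Pj , is-nothing-true nj , refl , trans (cong (λ p → suc ∣ p ∣) (lookup-ext {xs = vacant (out [ j ]≔ just (val i))} {ys = vacant out [ j ]≔ false} removed)) (∣∣-remove (vacant out) j (trans (lookup∘tabulate (ok out) j) okj))
      where
      removed : ∀ k → lookup (vacant (out [ j ]≔ just (val i))) k ≡ lookup (vacant out [ j ]≔ false) k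
      removed k rewrite lookup∘tabulate (ok (out [ j ]≔ just (val i))) k with k Fin.≟ j
      ... | yes refl rewrite lookup∘update j out (just (val i)) | lookup∘update j (vacant out) false = ∧-zeroʳ (P j)
      ... | no k≢j rewrite lookup∘update′ k≢j out (just (val i)) | lookup∘update′ k≢j (vacant out) false = sym (lookup∘tabulate (ok out) k)

    puts-induction : (Inv : Out → Set) {Q : Fin n → Set} →
      (∀ out {i j} → Q i → P j ≡ true → lookup out j ≡ nothing → Inv out → Inv (out [ j ]≔ just (val i))) →
      ∀ out {L} → All Q L → length L ≤ ∣ vacant out ∣ → Inv out → Inv (foldl put out L)
    puts-induction Inv pres out [] _ h = h
    puts-induction Inv pres out {i ∷ L} (qi ∷ qs) le h
      with j , _ , Pj , nj , e , c ← put-spec out i (≤-trans (s≤s z≤n) le)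
      = puts-induction Inv pres (put out i) qs (s≤s⁻¹ (≤-trans le (≤-reflexive (sym c)))) (subst Inv (sym e) (pres out qi Pj nj h))

    puts-vacant : ∀ out L → length L ≤ ∣ vacant out ∣ → ∣ vacant (foldl put out L) ∣ + length L ≡ ∣ vacant out ∣
    puts-vacant out [] le = +-identityʳ _
    puts-vacant out (i ∷ L) le
      with j , _ , _ , _ , _ , c ← put-spec out i (≤-trans (s≤s z≤n) le)
      = trans (+-suc _ _) (trans (cong suc (puts-vacant (put out i) L (s≤s⁻¹ (≤-trans le (≤-reflexive (sym c)))))) c)

    puts-full : ∀ out L → length L ≡ ∣ vacant out ∣ → ∀ j → P j ≡ true → ∃ λ a → lookup (foldl put out L) j ≡ just a
    puts-full out L e j Pj
      with ∣∣-empty (vacant (foldl put out L)) (+-cancelʳ-≡ (length L) _ 0 (trans (puts-vacant out L (≤-reflexive e)) (sym e))) j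
    ... | full rewrite lookup∘tabulate (ok (foldl put out L)) j | Pj with lookup (foldl put out L) j
    ... | just a = a , refl

  -- Queue lengths under the placement of one customer

  bit : Bool → ℕ
  bit false = 0
  bit true  = 1

  -- `Step` with the arrival already counted in the length. A further customer at a site then simply
  -- raises the load by one, whether it arrives there or comes from the preceding site.
  data LStep : ℕ → Bool → ℕ → Bool → Set where
    through : LStep x false x false
    served  : LStep (suc x) true x true
    empty   : LStep 0 true 0 false

  LStep⇒Step : ∀ a x → LStep (bit a + x) b y d → ∃ λ r → Step x a b y d r
  LStep⇒Step false x       through = _ , idle
  LStep⇒Step true  x       through = _ , wait
  LStep⇒Step false (suc x) served  = _ , serve
  LStep⇒Step true  x       served  = _ , pass
  LStep⇒Step false zero    empty   = _ , unused

  LStep-suc : LStep x b y d → b ∧ not d ≡ false → LStep (suc x) b (suc y) d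
  LStep-suc through _ = through
  LStep-suc served  _ = served

  LStep-settle : LStep x b y d → b ∧ not d ≡ true → LStep (suc x) b y true
  LStep-settle empty _ = served

  Cyclic : (A q D : Fin n → Bool) → (Fin n → ℕ) → Set
  Cyclic {n} A q D X = ∀ k → LStep (bit (A k) + X k) (q k) (X (csucc k)) (D k)

  -- A customer has joined the queue at site j but has not yet been passed on.
  Pending : (A q D : Fin n → Bool) → (Fin n → ℕ) → Fin n → Set
  Pending A q D X j =
    (∀ k → k ≢ j → LStep (bit (A k) + X k) (q k) (X (csucc k)) (D k)) ×
    (∃ λ l → bit (A j) + X j ≡ suc l × LStep l (q j) (X (csucc j)) (D j))

  settle : ∀ {A q D D' : Fin n → Bool} (ok : Fin n → Bool) → (∀ k → ok k ≡ q k ∧ not (D k)) →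
    ∀ m j j' X → findFrom csucc ok m j ≡ just j' → D' j' ≡ true → (∀ k → k ≢ j' → D' k ≡ D k) →
    Pending A q D X j → ∃ (Cyclic A q D')
  settle {n} {A} {q} {D} {D'} ok ok≡ (suc m) j j' X found D'j' D'k (others , l , load , lst) with ok j in okj
  ... | true with refl ← found = X , settled
    where
    settled : Cyclic A q D' X
    settled k with k Fin.≟ j
    ... | no k≢j rewrite D'k k k≢j = others k k≢j
    ... | yes refl rewrite load | D'j' = LStep-settle lst (trans (sym (ok≡ j)) okj)
  ... | false = settle {D' = D'} ok ok≡ m (csucc j) j' X' found D'j' D'k (others' , _ , load' , last')
    where
    X' : Fin n → ℕ
    X' = updateAt X (csucc j) suc
    bumped : LStep (bit (A j) + X j) (q j) (X' (csucc j)) (D j)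
    bumped rewrite load | updateAt-updates (csucc j) {suc} X = LStep-suc lst (trans (sym (ok≡ j)) okj)
    next : ∀ k → LStep (bit (A k) + X k) (q k) (X' (csucc k)) (D k)
    next k with k Fin.≟ j
    ... | yes refl = bumped
    ... | no k≢j rewrite updateAt-minimal (csucc k) (csucc j) {suc} X (k≢j ∘ csucc-injective) = others k k≢j
    others' : ∀ k → k ≢ csucc j → LStep (bit (A k) + X' k) (q k) (X' (csucc k)) (D k)
    others' k k≢ rewrite updateAt-minimal k (csucc j) {suc} X k≢ = next k
    load' : bit (A (csucc j)) + X' (csucc j) ≡ suc (bit (A (csucc j)) + X (csucc j))
    load' rewrite updateAt-updates (csucc j) {suc} X = +-suc _ _
    last' : LStep (bit (A (csucc j)) + X (csucc j)) (q (csucc j)) (X' (csucc (csucc j))) (D (csucc j))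
    last' = next (csucc j)

  arrive : ∀ {A A' q D : Fin n → Bool} i X → A i ≡ false → A' i ≡ true → (∀ k → k ≢ i → A' k ≡ A k) →
    Cyclic A q D X → Pending A' q D X i
  arrive {A = A} {A'} {q} {D} i X Ai A'i A'k cyc =
      (λ k k≢i → subst (λ a → LStep (bit a + X k) (q k) (X (csucc k)) (D k)) (sym (A'k k k≢i)) (cyc k))
    , X i , cong (λ a → bit a + X i) A'i , subst (λ a → LStep (bit a + X i) (q i) (X (csucc i)) (D i)) Ai (cyc i)

  linear-run : ∀ {n} (X : Fin (suc n) → ℕ) (A q D : Subset n) →
    (∀ k → LStep (bit (lookup A k) + X (inject₁ k)) (lookup q k) (X (suc k)) (lookup D k)) →
    ∃ λ R → Run (X zero) A q (X (fromℕ n)) D R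
  linear-run X [] [] [] h = [] , []
  linear-run X (a ∷ A) (b ∷ q) (d ∷ D) h
    with r , s ← LStep⇒Step a (X zero) (h zero)
    with R , t ← linear-run (X ∘ suc) A q D (h ∘ suc) = r ∷ R , s ∷ t

  -- A linear run over `suc n` sites has one more length than sites; the last is identified with the
  -- first.
  wrap : Fin (suc (suc n)) → Fin (suc n)
  wrap {n} j with suc n ≟ toℕ j
  ... | yes _ = zero
  ... | no ne = lower₁ j ne

  wrap-inject₁ : (k : Fin (suc n)) → wrap (inject₁ k) ≡ k
  wrap-inject₁ {n} k with suc n ≟ toℕ (inject₁ k)
  ... | yes e = contradiction (trans e (toℕ-inject₁ k)) (>⇒≢ (toℕ<n k))
  ... | no ne = lower₁-inject₁′ k ne

  wrap-suc : (k : Fin (suc n)) → wrap (suc k) ≡ csucc k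
  wrap-suc {n} k with initLast k
  ... | init i = trans (wrap-inject₁ (suc i)) (sym (csucc-inject₁ i))
  ... | last = trans wrap-last (sym (csucc-fromℕ n))
    where
    wrap-last : wrap (fromℕ (suc n)) ≡ zero
    wrap-last with suc n ≟ toℕ (fromℕ (suc n))
    ... | yes _ = refl
    ... | no ne = contradiction (sym (toℕ-fromℕ (suc n))) ne

  Cyclic⇒Queue : (A q D : Subset n) → ∃ (Cyclic (lookup A) (lookup q) (lookup D)) → ∃ (Queue A q D)
  Cyclic⇒Queue [] [] [] _ = [] , 0 , []
  Cyclic⇒Queue {suc n} A q D (X , cyc)
    with R , t ← linear-run (X ∘ wrap) A q D (λ k → subst₂ (λ i j → LStep (bit (lookup A k) + X i) (lookup q k) (X j) (lookup D k))
                                                  (sym (wrap-inject₁ k)) (sym (wrap-suc k)) (cyc k))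
    = R , X zero , subst (λ j → Run (X zero) A q (X j) D R) (trans (wrap-suc (fromℕ n)) (csucc-fromℕ n)) t

  -- The action of a queue on a word

  ≤ᵇ-true : ∀ {m n} → m ≤ n → (m ≤ᵇ n) ≡ true
  ≤ᵇ-true = Equivalence.to T-≡ ∘ ≤⇒≤ᵇ

  ≤ᵇ-true⁻ : ∀ {m n} → (m ≤ᵇ n) ≡ true → m ≤ n
  ≤ᵇ-true⁻ {m} {n} = ≤ᵇ⇒≤ m n ∘ Equivalence.from T-≡

  ≤ᵇ-false : ∀ {m n} → n < m → (m ≤ᵇ n) ≡ false
  ≤ᵇ-false {m} {n} n<m with m ≤ᵇ n in e
  ... | false = refl
  ... | true = contradiction (≤ᵇ-true⁻ e) (<⇒≱ n<m)

  ≤ᵇ-false⁻ : ∀ {m n} → (m ≤ᵇ n) ≡ false → n < m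
  ≤ᵇ-false⁻ {m} {n} e with m ≤? n
  ... | no m≰n = ≰⇒> m≰n
  ... | yes m≤n with () ← trans (sym (≤ᵇ-true m≤n)) e

  module Sorted (u : Word n) where

    SortedBy : List (Fin n) → Set
    SortedBy = AllPairs (λ a b → lookup u a ≤ lookup u b)

    insertSite-↭ : ∀ j ks → insertSite u j ks ↭ j ∷ ks
    insertSite-↭ j [] = ↭-refl
    insertSite-↭ j (k ∷ ks) with lookup u j <ᵇ lookup u k
    ... | true = ↭-refl
    ... | false = ↭-trans (↭-prep k (insertSite-↭ j ks)) (↭-swap k j ↭-refl)

    insertSite-sorted : ∀ j ks → SortedBy ks → SortedBy (insertSite u j ks)
    insertSite-sorted j [] [] = [] ∷ []
    insertSite-sorted j (k ∷ ks) (k≤ ∷ s) with lookup u j <ᵇ lookup u k in e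
    ... | true = (j≤k ∷ All.map (≤-trans j≤k) k≤) ∷ k≤ ∷ s
      where j≤k = <⇒≤ (≤ᵇ-true⁻ {suc (lookup u j)} e)
    ... | false = All-resp-↭ (↭-sym (insertSite-↭ j ks)) (s≤s⁻¹ (≤ᵇ-false⁻ {suc (lookup u j)} e) ∷ k≤) ∷ insertSite-sorted j ks s

    insertAll-↭ : ∀ acc L → foldl (λ acc j → insertSite u j acc) acc L ↭ L ++ acc
    insertAll-↭ acc [] = ↭-refl
    insertAll-↭ acc (j ∷ L) = ↭-trans (insertAll-↭ (insertSite u j acc) L)
      (↭-trans (++⁺ˡ L (insertSite-↭ j acc)) (shift j L acc))

    insertAll-sorted : ∀ acc L → SortedBy acc → SortedBy (foldl (λ acc j → insertSite u j acc) acc L)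
    insertAll-sorted acc [] s = s
    insertAll-sorted acc (j ∷ L) s = insertAll-sorted _ L (insertSite-sorted j acc s)

    sortedSites-sorted : SortedBy (sortedSites u)
    sortedSites-sorted = insertAll-sorted [] (allFin n) []

    sortedSites-↭ : sortedSites u ↭ allFin n
    sortedSites-↭ = ↭-trans (insertAll-↭ [] (allFin n)) (↭-reflexive (++-identityʳ (allFin n)))

  Unique-resp-↭ : {L M : List (Fin n)} → L ↭ M → Unique L → Unique M
  Unique-resp-↭ {n} p = S.Unique-resp-↭ (↭⇒↭ₛ p)
    where
    import Data.List.Relation.Binary.Permutation.Setoid.Properties (setoid (Fin n)) as S

  AllPairs-across : ∀ {A : Set} {_~_ : A → A → Set} xs {ys} → AllPairs _~_ (xs ++ ys) → All (λ x → All (x ~_) ys) xs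
  AllPairs-across [] _ = []
  AllPairs-across (x ∷ xs) (px ∷ p) = All.++⁻ʳ xs px ∷ AllPairs-across xs p

  unique-≤ : ∀ {L : List (Fin n)} (p : Subset n) → Unique L → All (λ j → lookup p j ≡ true) L → length L ≤ ∣ p ∣
  unique-≤ p [] [] = z≤n
  unique-≤ p (j∉ ∷ un) (pj ∷ ps) = ≤-trans
    (s≤s (unique-≤ (p [ _ ]≔ false) un (All.zipWith (λ { (j≢ , e) → trans (lookup∘update′ (j≢ ∘ sym) p false) e }) (j∉ , ps))))
    (≤-reflexive (∣∣-remove p _ pj))

  S : ℕ → Word n → Subset n
  S k w = Vec.map (_≤ᵇ k) w

  lookup-S : ∀ k (w : Word n) j → lookup (S k w) j ≡ (lookup w j ≤ᵇ k)
  lookup-S k w j = lookup-map j (_≤ᵇ k) w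

  -- An unset site counts as above every threshold, so there are no departures before Phase II.
  thr : ℕ → Maybe ℕ → Bool
  thr k nothing  = false
  thr k (just a) = a ≤ᵇ k

  module PhaseII (q : Subset n) (u : Word n) (k : ℕ) where
    open Place csucc csucc-covering (isIn q) (lookup u) public

    AllLow : Out → Set
    AllLow out = ∀ j a → lookup q j ≡ true → lookup out j ≡ just a → (a ≤ᵇ k) ≡ true

    ok-low : ∀ out → AllLow out → ∀ j → ok out j ≡ lookup q j ∧ not (thr k (lookup out j))
    ok-low out low j with lookup q j in qj | lookup out j in oj
    ... | false | _ = refl
    ... | true | nothing = refl
    ... | true | just a rewrite low j a qj oj = refl

    Cyclic-cong : ∀ {A A' D D' X} → (∀ j → A j ≡ A' j) → (∀ j → D j ≡ D' j) → Cyclic A (lookup q) D X → Cyclic A' (lookup q) D' X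
    Cyclic-cong {X = X} eA eD cyc j = subst₂ (λ a d → LStep (bit a + X j) (lookup q j) (X (csucc j)) d) (eA j) (eD j) (cyc j)

    puts-high : ∀ {out L} → All (λ i → (lookup u i ≤ᵇ k) ≡ false) L → length L ≤ ∣ vacant out ∣ →
      ∀ j → thr k (lookup out j) ≡ thr k (lookup (foldl put out L) j)
    puts-high {out} high le = puts-induction (λ out' → ∀ j → thr k (lookup out j) ≡ thr k (lookup out' j)) pres out high le (λ _ → refl)
      where
      pres : ∀ out' {i j'} → (lookup u i ≤ᵇ k) ≡ false → isIn q j' ≡ true → lookup out' j' ≡ nothing →
        (∀ j → thr k (lookup out j) ≡ thr k (lookup out' j)) →
        ∀ j → thr k (lookup out j) ≡ thr k (lookup (out' [ j' ]≔ just (lookup u i)) j)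
      pres out' {i} {j'} hi _ oj' h j with j Fin.≟ j'
      ... | yes refl rewrite lookup∘update j out' (just (lookup u i)) = trans (h j) (trans (cong (thr k) oj') (sym hi))
      ... | no j≢j' rewrite lookup∘update′ j≢j' out' (just (lookup u i)) = h j

    puts-cyclic : ∀ L out A X →
      AllPairs (λ a b → lookup u a ≤ lookup u b) L → Unique L →
      length L ≤ ∣ vacant out ∣ → AllLow out →
      (∀ j → j ∈ L ⊎ A j ≡ (lookup u j ≤ᵇ k)) → All (λ j → A j ≡ false) L →
      Cyclic A (lookup q) (λ j → thr k (lookup out j)) X →
      ∃ (Cyclic (λ j → lookup u j ≤ᵇ k) (lookup q) (λ j → thr k (lookup (foldl put out L) j)))
    puts-cyclic [] out A X _ _ _ _ hA _ cyc = X , Cyclic-cong (λ j → fromInj₂ (hA j)) (λ _ → refl) cyc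
      where
      fromInj₂ : ∀ {j : Fin n} {B : Set} → j ∈ [] ⊎ B → B
      fromInj₂ (inj₂ b) = b
    puts-cyclic (i ∷ L) out A X (i≤ ∷ sorted) (i∉ ∷ uniq) le low hA (Ai ∷ AL) cyc with lookup u i ≤ᵇ k in ui
    ... | false = X , Cyclic-cong A≡ (puts-high high le) cyc
      where
      high : All (λ i → (lookup u i ≤ᵇ k) ≡ false) (i ∷ L)
      high = ui ∷ All.map (λ i≤j → ≤ᵇ-false (<-≤-trans (≤ᵇ-false⁻ ui) i≤j)) i≤
      A≡ : ∀ j → A j ≡ (lookup u j ≤ᵇ k)
      A≡ j with hA j
      ... | inj₁ j∈ = trans (All.lookup (Ai ∷ AL) j∈) (sym (All.lookup high j∈))
      ... | inj₂ e = e
    ... | true with j , found , _ , oj , eq , c ← put-spec out i (≤-trans (s≤s z≤n) le)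
      with X⁺ , cyc' ← settle {D' = λ j' → thr k (lookup (out [ j ]≔ just (lookup u i)) j')} (ok out) (ok-low out low) n i j X found
             (trans (cong (thr k) (lookup∘update j out _)) ui)
             (λ l l≢j → cong (thr k) (lookup∘update′ l≢j out _))
             (arrive i X Ai (updateAt-updates i {const true} A) (λ l l≢i → updateAt-minimal l i {const true} A l≢i) cyc)
      = puts-cyclic L (put out i) A⁺ X⁺ sorted uniq (s≤s⁻¹ (≤-trans le (≤-reflexive (sym c)))) low' hA⁺
          (All.zipWith (λ { (i≢l , Al) → trans (updateAt-minimal _ i A (i≢l ∘ sym)) Al }) (i∉ , AL))
          (subst (λ o → Cyclic A⁺ (lookup q) (λ j → thr k (lookup o j)) X⁺) (sym eq) cyc')
      where
      A⁺ : Fin n → Bool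
      A⁺ = updateAt A i (const true)
      hA⁺ : ∀ l → l ∈ L ⊎ A⁺ l ≡ (lookup u l ≤ᵇ k)
      hA⁺ l with l Fin.≟ i
      ... | yes refl = inj₂ (trans (updateAt-updates i A) (sym ui))
      ... | no l≢i with hA l
      ...   | inj₁ (here l≡i) = contradiction l≡i l≢i
      ...   | inj₁ (there l∈) = inj₁ l∈
      ...   | inj₂ e = inj₂ (trans (updateAt-minimal l i A l≢i) e)
      low' : AllLow (put out i)
      low' l a ql ol rewrite eq with l Fin.≟ j
      ... | yes refl rewrite lookup∘update j out (just (lookup u i)) with refl ← ol = ui
      ... | no l≢j rewrite lookup∘update′ l≢j out (just (lookup u i)) = low l a ql ol

  module Apply (q : Subset n) (u : Word n) (K : ℕ)
    (u≤K : ∀ j → lookup u j ≤ K) (small : ∀ k → k < K → ∣ S k u ∣ ≤ ∣ q ∣) where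

    open Sorted u

    early late : List (Fin n)
    early = take ∣ q ∣ (sortedSites u)
    late  = drop ∣ q ∣ (sortedSites u)

    length-sorted : length (sortedSites u) ≡ n
    length-sorted = trans (↭-length sortedSites-↭) (length-tabulate (λ i → i))

    length-early : length early ≡ ∣ q ∣
    length-early = trans (length-take ∣ q ∣ (sortedSites u)) (trans (cong (∣ q ∣ ⊓_) length-sorted) (m≤n⇒m⊓n≡m (∣p∣≤n q)))

    length-late : length late ≡ n ∸ ∣ q ∣
    length-late = trans (length-drop ∣ q ∣ (sortedSites u)) (cong (_∸ ∣ q ∣) length-sorted)

    unique-sorted : Unique (sortedSites u)
    unique-sorted = Unique-resp-↭ (↭-sym sortedSites-↭) (allFin⁺ n)

    early++late : early ++ late ≡ sortedSites u
    early++late = take++drop≡id ∣ q ∣ (sortedSites u)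

    -- A late site with a letter below `K` would, together with the `∣ q ∣` early sites, whose
    -- letters are no larger, violate `small`. Phase I thus writes only the letter `suc K`, and its
    -- order and direction leave no trace.
    late-K : ∀ {i} → i ∈ late → lookup u i ≡ K
    late-K {i} i∈ with lookup u i ≟ K
    ... | yes e = e
    ... | no ne = contradiction (≤-trans too-many (small (lookup u i) (≤∧≢⇒< (u≤K i) ne))) (<⇒≱ (≤-reflexive (cong suc (sym length-early))))
      where
      too-many : suc (length early) ≤ ∣ S (lookup u i) u ∣
      too-many = unique-≤ (S (lookup u i) u)
        (All.map (λ j≢ → (All.lookup j≢ i∈) ∘ sym) (AllPairs-across early (subst Unique (sym early++late) unique-sorted))
          ∷ AllPairs.take⁺ ∣ q ∣ unique-sorted)
        (trans (lookup-S (lookup u i) u i) (≤ᵇ-true (≤-refl {lookup u i}))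
          ∷ All.map (λ {j} j≤ → trans (lookup-S (lookup u i) u j) (≤ᵇ-true (All.lookup j≤ i∈))) (AllPairs-across early (subst SortedBy (sym early++late) sortedSites-sorted)))

    module I = Place cpred cpred-covering (not ∘ isIn q) (suc ∘ lookup u)

    o₁ o₂ : Vec (Maybe ℕ) n
    o₁ = foldl (phaseI q u) (replicate n nothing) (List.reverse late)
    o₂ = foldl (phaseII q u) o₁ early

    vacant₀ : I.vacant (replicate n nothing) ≡ ∁ q
    vacant₀ = lookup-ext λ j → trans (lookup∘tabulate (I.ok (replicate n nothing)) j)
      (trans (cong (λ o → not (lookup q j) ∧ is-nothing o) (lookup-replicate j nothing)) (trans (∧-identityʳ _) (sym (lookup-map j not q))))

    length-late′ : length (List.reverse late) ≡ ∣ I.vacant (replicate n nothing) ∣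
    length-late′ = trans (length-reverse late) (trans length-late (trans (sym (∣∁p∣≡n∸∣p∣ q)) (cong ∣_∣ (sym vacant₀))))

    Inv₁ : Vec (Maybe ℕ) n → Set
    Inv₁ out = ∀ j → lookup out j ≡ nothing ⊎ (lookup q j ≡ false × lookup out j ≡ just (suc K))

    inv₁ : Inv₁ o₁
    inv₁ = I.puts-induction Inv₁ {Q = λ i → lookup u i ≡ K} pres (replicate n nothing)
      (All-resp-↭ (↭-sym (↭-reverse late)) (All.tabulate late-K)) (≤-reflexive length-late′) (λ j → inj₁ (lookup-replicate j nothing))
      where
      not-true : ∀ {b} → not b ≡ true → b ≡ false
      not-true {false} _ = refl
      pres : ∀ out {i j} → lookup u i ≡ K → not (isIn q j) ≡ true → lookup out j ≡ nothing → Inv₁ out → Inv₁ (out [ j ]≔ just (suc (lookup u i)))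
      pres out {i} {j} refl qj _ h l with l Fin.≟ j
      ... | yes refl = inj₂ (not-true qj , lookup∘update l out _)
      ... | no l≢j rewrite lookup∘update′ l≢j out (just (suc (lookup u i))) = h l

    o₁-out : ∀ j → lookup q j ≡ false → lookup o₁ j ≡ just (suc K)
    o₁-out j qj with inv₁ j | I.puts-full (replicate n nothing) (List.reverse late) length-late′ j (cong not qj)
    ... | inj₂ (_ , e) | _ = e
    ... | inj₁ e | a , e' with () ← trans (sym e) e'

    o₁-in : ∀ j → lookup q j ≡ true → lookup o₁ j ≡ nothing
    o₁-in j qj with inv₁ j
    ... | inj₁ e = e
    ... | inj₂ (e , _) with () ← trans (sym e) qj

    module II = Place csucc csucc-covering (isIn q) (lookup u)

    vacant₁ : II.vacant o₁ ≡ q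
    vacant₁ = lookup-ext λ j → trans (lookup∘tabulate (II.ok o₁) j) (at j)
      where
      at : ∀ j → II.ok o₁ j ≡ lookup q j
      at j with lookup q j in qj
      ... | false = refl
      ... | true rewrite o₁-in j qj = refl

    length-early′ : length early ≡ ∣ II.vacant o₁ ∣
    length-early′ = trans length-early (cong ∣_∣ (sym vacant₁))

    Inv₂ : Vec (Maybe ℕ) n → Set
    Inv₂ out = ∀ j → (lookup q j ≡ false × lookup out j ≡ just (suc K)) ⊎
      (lookup q j ≡ true × ∀ a → lookup out j ≡ just a → a ≤ K)

    inv₂ : Inv₂ o₂
    inv₂ = II.puts-induction Inv₂ {Q = λ i → lookup u i ≤ K} pres o₁ {early} (All.tabulate (λ {i} _ → u≤K i)) (≤-reflexive length-early′) start
      where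
      start : Inv₂ o₁
      start j with lookup q j in qj
      ... | false = inj₁ (refl , o₁-out j qj)
      ... | true = inj₂ (refl , λ a e → case-none (trans (sym (o₁-in j qj)) e))
        where
        case-none : ∀ {a} → nothing ≡ just a → a ≤ K
        case-none ()
      pres : ∀ out {i j} → lookup u i ≤ K → isIn q j ≡ true → lookup out j ≡ nothing → Inv₂ out → Inv₂ (out [ j ]≔ just (lookup u i))
      pres out {i} {j} ui≤K qj _ h l with l Fin.≟ j
      ... | yes refl = inj₂ (qj , λ { a e → subst (_≤ K) (just-injective (trans (sym (lookup∘update l out _)) e)) ui≤K })
      ... | no l≢j rewrite lookup∘update′ l≢j out (just (lookup u i)) = h l

    v : Word n
    v = applyQueue q u

    lookup-v : ∀ j a → lookup o₂ j ≡ just a → lookup v j ≡ a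
    lookup-v j a e = trans (lookup-map j (fromMaybe 0) o₂) (cong (fromMaybe 0) e)

    site : ∀ j → (lookup q j ≡ false × lookup o₂ j ≡ just (suc K)) ⊎ (lookup q j ≡ true × ∃ λ a → lookup o₂ j ≡ just a × a ≤ K)
    site j with inv₂ j
    ... | inj₁ h = inj₁ h
    ... | inj₂ (qj , h) with a , e ← II.puts-full o₁ early length-early′ j qj = inj₂ (qj , a , e , h a e)

    bound : ∀ j → lookup v j ≤ suc K
    bound j with site j
    ... | inj₁ (_ , e) rewrite lookup-v j _ e = ≤-refl
    ... | inj₂ (_ , a , e , a≤K) rewrite lookup-v j a e = m≤n⇒m≤1+n a≤K

    S-top : S K v ≡ q
    S-top = lookup-ext λ j → trans (lookup-S K v j) (at j)
      where
      at : ∀ j → (lookup v j ≤ᵇ K) ≡ lookup q j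
      at j with site j
      ... | inj₁ (qj , e) rewrite lookup-v j _ e | qj = ≤ᵇ-false (n<1+n K)
      ... | inj₂ (qj , a , e , a≤K) rewrite lookup-v j a e | qj = ≤ᵇ-true a≤K

    S-queue : ∀ k → k < K → ∃ (Queue (S k u) q (S k v))
    S-queue k k<K = Cyclic⇒Queue (S k u) q (S k v) (map₂ (λ {X} → Cyclic-cong {X = X} (λ j → sym (lookup-S k u j)) D≡) final)
      where
      open PhaseII q u k
      low₁ : ∀ j → thr k (lookup o₁ j) ≡ false
      low₁ j with lookup q j in qj
      ... | false rewrite o₁-out j qj = ≤ᵇ-false (m<n⇒m<1+n k<K)
      ... | true rewrite o₁-in j qj = refl
      D≡ : ∀ j → thr k (lookup o₂ j) ≡ lookup (S k v) j
      D≡ j with site j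
      ... | inj₁ (_ , e) rewrite e = sym (trans (lookup-S k v j) (cong (_≤ᵇ k) (lookup-v j _ e)))
      ... | inj₂ (_ , a , e , _) rewrite e = sym (trans (lookup-S k v j) (cong (_≤ᵇ k) (lookup-v j _ e)))
      start : Cyclic (λ _ → false) (lookup q) (λ j → thr k (lookup o₁ j)) (λ _ → 0)
      start j rewrite low₁ j with lookup q j
      ... | false = through
      ... | true = empty
      final : ∃ (Cyclic (λ j → lookup u j ≤ᵇ k) (lookup q) (λ j → thr k (lookup o₂ j)))
      final = puts-cyclic early o₁ (λ _ → false) (λ _ → 0)
        (AllPairs.take⁺ ∣ q ∣ sortedSites-sorted) (AllPairs.take⁺ ∣ q ∣ unique-sorted)
        (≤-reflexive length-early′)
        (λ j a qj oj → case-none (trans (sym (o₁-in j qj)) oj))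
        arrivals (All.tabulate (λ _ → refl)) start
        where
        case-none : ∀ {a} {B : Set} → nothing ≡ just a → B
        case-none ()
        arrivals : ∀ j → j ∈ early ⊎ false ≡ (lookup u j ≤ᵇ k)
        arrivals j with ∈-++⁻ early (subst (j ∈_) (sym early++late) (∈-resp-↭ (↭-sym sortedSites-↭) (∈-allFin j)))
        ... | inj₁ j∈ = inj₁ j∈
        -- A late site carries `K`, which exceeds `k`, so it is not an arrival: all arrivals are
        -- treated in Phase II.
        ... | inj₂ j∈ rewrite late-K j∈ = inj₂ (sym (≤ᵇ-false k<K))

  -- Flags, merging, and the words reached by queues

  ≤ᵇ-injective : (∀ k → (x ≤ᵇ k) ≡ (y ≤ᵇ k)) → x ≡ y
  ≤ᵇ-injective {x} {y} e = ≤-antisym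
    (≤ᵇ-true⁻ (trans (e y) (≤ᵇ-true (≤-refl {y}))))
    (≤ᵇ-true⁻ (trans (sym (e x)) (≤ᵇ-true (≤-refl {x}))))

  S-injective : {v w : Word n} → (∀ k → S k v ≡ S k w) → v ≡ w
  S-injective {v = v} {w} e = lookup-ext λ j → ≤ᵇ-injective λ k →
    trans (sym (lookup-S k v j)) (trans (cong (λ s → lookup s j) (e k)) (lookup-S k w j))

  S-full : ∀ {k} {w : Word n} → (∀ j → lookup w j ≤ k) → S k w ≡ ⊤
  S-full {k = k} {w} le = lookup-ext λ j → trans (lookup-S k w j) (trans (≤ᵇ-true (le j)) (sym (lookup-replicate j true)))

  merge-≤ᵇ-< : ∀ a → k < i → ((if i <ᵇ a then a ∸ 1 else a) ≤ᵇ k) ≡ (a ≤ᵇ k)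
  merge-≤ᵇ-< {k} {i} a k<i with i <ᵇ a in e
  ... | false = refl
  ... | true = trans (≤ᵇ-false (<-≤-trans k<i (∸-monoˡ-≤ 1 i<a))) (sym (≤ᵇ-false (<-trans k<i i<a)))
    where i<a = ≤ᵇ-true⁻ {suc i} {a} e

  merge-≤ᵇ-≥ : ∀ a → i ≤ k → ((if i <ᵇ a then a ∸ 1 else a) ≤ᵇ k) ≡ (a ≤ᵇ suc k)
  merge-≤ᵇ-≥ {i} {k} a i≤k with i <ᵇ a in e
  ... | false = trans (≤ᵇ-true a≤k) (sym (≤ᵇ-true (m≤n⇒m≤1+n a≤k)))
    where a≤k = ≤-trans (s≤s⁻¹ (≤ᵇ-false⁻ {suc i} {a} e)) i≤k
  merge-≤ᵇ-≥ {i} {k} (suc zero) i≤k | true = refl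
  merge-≤ᵇ-≥ {i} {k} (suc (suc a)) i≤k | true = refl

  S-merge-< : (w : Word n) → k < i → S k (mergeWord i w) ≡ S k w
  S-merge-< {k = k} {i} w k<i = lookup-ext λ j → trans (lookup-S k (mergeWord i w) j)
    (trans (cong (_≤ᵇ k) (lookup-map j _ w)) (trans (merge-≤ᵇ-< (lookup w j) k<i) (sym (lookup-S k w j))))

  S-merge-≥ : (w : Word n) → i ≤ k → S k (mergeWord i w) ≡ S (suc k) w
  S-merge-≥ {i = i} {k} w i≤k = lookup-ext λ j → trans (lookup-S k (mergeWord i w) j)
    (trans (cong (_≤ᵇ k) (lookup-map j _ w)) (trans (merge-≤ᵇ-≥ (lookup w j) i≤k) (sym (lookup-S (suc k) w j))))

  -- The invariant of a word obtained from `allOnes` by queues of sizes `sz 1`, ..., `sz (K ∸ 1)`.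
  -- Consecutive sizes may coincide, so classes may be empty.
  record Good (sz : ℕ → ℕ) (K : ℕ) (w : Word n) : Set where
    field
      size : ∀ k → k < K → ∣ S k w ∣ ≡ sz k
      full : ∀ k → K ≤ k → S k w ≡ ⊤
  open Good

  good-≤ : ∀ {sz K} {w : Word n} → Good sz K w → ∀ j → lookup w j ≤ K
  good-≤ {K = K} {w} g j = ≤ᵇ-true⁻ (trans (sym (lookup-S K w j)) (trans (cong (λ s → lookup s j) (full g K ≤-refl)) (lookup-replicate j true)))

  module Act {sz K} {w : Word n} (g : Good sz K w) (q : Subset n) (fits : ∀ k → k < K → sz k ≤ ∣ q ∣) where
    open Apply q w K (good-≤ g) (λ k k<K → ≤-trans (≤-reflexive (size g k k<K)) (fits k k<K)) public
      using (S-top; S-queue; bound)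

    S-suc : ∀ k → K < k → S k (applyQueue q w) ≡ ⊤
    S-suc k K<k = S-full λ j → ≤-trans (bound j) K<k

    S-size : ∀ k → k < K → ∣ S k (applyQueue q w) ∣ ≡ sz k
    S-size k k<K = trans (queue-served (proj₂ (S-queue k k<K))) (size g k k<K)

    act-good : ∣ q ∣ ≡ sz K → Good sz (suc K) (applyQueue q w)
    act-good e .size k k<1+K with m≤n⇒m<n∨m≡n (s≤s⁻¹ k<1+K)
    ... | inj₁ k<K = S-size k k<K
    ... | inj₂ refl = trans (cong ∣_∣ S-top) e
    act-good e .full k K<k = S-suc k K<k

    -- The only flag member whose size is that of `q` is the one just created, and merging at `K`
    -- forgets it. The larger queue can therefore act early without disturbing the sizes.
    merge-top-good : Good sz K (mergeWord K (applyQueue q w))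
    merge-top-good .size k k<K = trans (cong ∣_∣ (S-merge-< (applyQueue q w) k<K)) (S-size k k<K)
    merge-top-good .full k K≤k = trans (S-merge-≥ (applyQueue q w) K≤k) (S-suc (suc k) (s≤s K≤k))

  Monotone : (ℕ → ℕ) → Set
  Monotone sz = ∀ {j k} → j ≤ k → sz j ≤ sz k

  -- The flags agree only after merging: `q` is the member forgotten on the left, `Q` the one
  -- forgotten on the right. At `K` the left has the departures of `q'` through `q`, namely `P`, and
  -- the right has `P` as its newest member. The members below `K` are matched by `interchange`.
  merge-interchange : ∀ {sz K} {w : Word n} → Monotone sz → Good sz K w →
    ∀ {q' q P Q} → ∣ q' ∣ ≡ sz K → sz K ≤ ∣ q ∣ → Queue q' q P Q →
    mergeWord (suc K) (applyQueue q (applyQueue q' w)) ≡ applyQueue P (mergeWord K (applyQueue Q w))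
  merge-interchange {sz = sz} {K} {w} mono g {q'} {q} {P} {Q} e' e que = S-injective at
    where
    module A₁ = Act g q' (λ k k<K → ≤-trans (mono (<⇒≤ k<K)) (≤-reflexive (sym e')))
    module A₂ = Act (A₁.act-good e') q (λ k k<K → ≤-trans (mono (s≤s⁻¹ k<K)) e)
    module B₁ = Act g Q (λ k k<K → ≤-trans (mono (<⇒≤ k<K)) (≤-trans e (≤-reflexive (sym (queue-residue que)))))
    module B₂ = Act B₁.merge-top-good P (λ k k<K → ≤-trans (mono (<⇒≤ k<K)) (≤-reflexive (sym (trans (queue-served que) e'))))
    at : ∀ k → S k (mergeWord (suc K) (applyQueue q (applyQueue q' w))) ≡ S k (applyQueue P (mergeWord K (applyQueue Q w)))
    at k with <-cmp k K
    ... | tri< k<K _ _ = trans (S-merge-< (applyQueue q (applyQueue q' w)) (m<n⇒m<1+n k<K))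
      (interchange (subst (_≤ ∣ q ∣) (sym e') e) (proj₂ (A₁.S-queue k k<K)) (proj₂ (A₂.S-queue k (m<n⇒m<1+n k<K))) que
        (proj₂ (B₁.S-queue k k<K))
        (subst (λ A → Queue A P (S k (applyQueue P (mergeWord K (applyQueue Q w)))) (proj₁ (B₂.S-queue k k<K)))
          (S-merge-< (applyQueue Q w) k<K) (proj₂ (B₂.S-queue k k<K))))
    ... | tri≈ _ refl _ = trans (S-merge-< (applyQueue q (applyQueue q' w)) (n<1+n K))
      (trans (proj₁ (Queue-functional
        (subst (λ A → Queue A q (S K (applyQueue q (applyQueue q' w))) (proj₁ (A₂.S-queue K (n<1+n K)))) A₁.S-top (proj₂ (A₂.S-queue K (n<1+n K)))) que))
        (sym B₂.S-top))
    ... | tri> _ _ K<k = trans (S-merge-≥ (applyQueue q (applyQueue q' w)) K<k) (trans (A₂.S-suc (suc k) (s≤s K<k)) (sym (B₂.S-suc k K<k)))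

  Skips : ℕ → (sz sz' : ℕ → ℕ) → Set
  Skips i sz sz' = (∀ k → k < i → sz' k ≡ sz k) × (∀ k → i ≤ k → sz' k ≡ sz (suc k))

  merge-good : ∀ {sz sz' K} {w : Word n} → Skips i sz sz' → i ≤ K → Good sz (suc K) w → Good sz' K (mergeWord i w)
  merge-good {i = i} {w = w} (below , above) i≤K g .size k k<K with k <? i
  ... | yes k<i = trans (cong ∣_∣ (S-merge-< w k<i)) (trans (size g k (m<n⇒m<1+n k<K)) (sym (below k k<i)))
  ... | no k≮i = trans (cong ∣_∣ (S-merge-≥ w (≮⇒≥ k≮i))) (trans (size g (suc k) (s≤s k<K)) (sym (above k (≮⇒≥ k≮i))))
  merge-good {w = w} _ i≤K g .full k K≤k = trans (S-merge-≥ w (≤-trans i≤K K≤k)) (full g (suc k) (s≤s K≤k))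

  -- A queue transports each flag member independently of the others, and the member it creates lies
  -- above `i`. Hence the `i`-th member may be forgotten before or after serving.
  merge-applyQueue : ∀ {sz sz' K} {w : Word n} → Skips i sz sz' → i ≤ K → Good sz (suc K) w →
    ∀ q → (∀ k → k < suc K → sz k ≤ ∣ q ∣) → mergeWord i (applyQueue q w) ≡ applyQueue q (mergeWord i w)
  merge-applyQueue {i = i} {sz = sz} {sz'} {K} {w} sk i≤K g q fits = S-injective at
    where
    fits' : ∀ k → k < K → sz' k ≤ ∣ q ∣
    fits' k k<K with k <? i
    ... | yes k<i = ≤-trans (≤-reflexive (proj₁ sk k k<i)) (fits k (m<n⇒m<1+n k<K))
    ... | no k≮i = ≤-trans (≤-reflexive (proj₂ sk k (≮⇒≥ k≮i))) (fits (suc k) (s≤s k<K))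
    module A = Act g q fits
    module B = Act (merge-good sk i≤K g) q fits'
    via : ∀ k l (l<1+K : l < suc K) → (k<K : k < K) → S k (mergeWord i w) ≡ S l w → S l (applyQueue q w) ≡ S k (applyQueue q (mergeWord i w))
    via k l l<1+K k<K e = proj₁ (Queue-functional (proj₂ (A.S-queue l l<1+K))
      (subst (λ A → Queue A q (S k (applyQueue q (mergeWord i w))) (proj₁ (B.S-queue k k<K))) e (proj₂ (B.S-queue k k<K))))
    at : ∀ k → S k (mergeWord i (applyQueue q w)) ≡ S k (applyQueue q (mergeWord i w))
    at k with k <? i
    ... | yes k<i = trans (S-merge-< (applyQueue q w) k<i)
      (via k k (m<n⇒m<1+n (<-≤-trans k<i i≤K)) (<-≤-trans k<i i≤K) (S-merge-< w k<i))
    ... | no k≮i with <-cmp k K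
    ... | tri< k<K _ _ = trans (S-merge-≥ (applyQueue q w) (≮⇒≥ k≮i)) (via k (suc k) (s≤s k<K) k<K (S-merge-≥ w (≮⇒≥ k≮i)))
    ... | tri≈ _ refl _ = trans (S-merge-≥ (applyQueue q w) i≤K) (trans A.S-top (sym B.S-top))
    ... | tri> _ _ K<k = trans (S-merge-≥ (applyQueue q w) (≮⇒≥ k≮i)) (trans (A.S-suc (suc k) (s≤s K<k)) (sym (B.S-suc k K<k)))

  -- Flag sizes, types and numbers of classes

  ≤ᵇ-suc : ∀ a k → (if a ≤ᵇ suc k then 1 else 0) ≡ (if a ≡ᵇ suc k then 1 else 0) + (if a ≤ᵇ k then 1 else 0)
  ≤ᵇ-suc zero k = refl
  ≤ᵇ-suc (suc zero) zero = refl
  ≤ᵇ-suc (suc (suc a)) zero = refl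
  ≤ᵇ-suc (suc a) (suc k) = trans (cong (if_then 1 else 0) (≤ᵇ-peel a (suc k)))
    (trans (≤ᵇ-suc a k) (cong (λ b → (if a ≡ᵇ suc k then 1 else 0) + (if b then 1 else 0)) (sym (≤ᵇ-peel a k))))
    where
    ≤ᵇ-peel : ∀ a k → (suc a ≤ᵇ suc k) ≡ (a ≤ᵇ k)
    ≤ᵇ-peel zero    k = refl
    ≤ᵇ-peel (suc a) k = refl

  ∣∷∣ : ∀ b (s : Subset n) → ∣ b ∷ s ∣ ≡ (if b then 1 else 0) + ∣ s ∣
  ∣∷∣ true s = refl
  ∣∷∣ false s = refl

  ∣S∣-suc : ∀ k (w : Word n) → ∣ S (suc k) w ∣ ≡ count (suc k) w + ∣ S k w ∣
  ∣S∣-suc k [] = refl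
  ∣S∣-suc k (a ∷ w) = begin
    ∣ S (suc k) (a ∷ w) ∣                     ≡⟨ ∣∷∣ (a ≤ᵇ suc k) (S (suc k) w) ⟩
    (if a ≤ᵇ suc k then 1 else 0) + ∣ S (suc k) w ∣
                                              ≡⟨ cong₂ _+_ (≤ᵇ-suc a k) (∣S∣-suc k w) ⟩
    (e + l) + (count (suc k) w + ∣ S k w ∣)   ≡⟨ +-interchange e l (count (suc k) w) ∣ S k w ∣ ⟩
    (e + count (suc k) w) + (l + ∣ S k w ∣)   ≡⟨ cong (e + count (suc k) w +_) (sym (∣∷∣ (a ≤ᵇ k) (S k w))) ⟩
    count (suc k) (a ∷ w) + ∣ S k (a ∷ w) ∣   ∎
    where
    open ≡-Reasoning
    open import Algebra.Properties.CommutativeSemigroup +-commutativeSemigroup using () renaming (interchange to +-interchange)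
    e l : ℕ
    e = if a ≡ᵇ suc k then 1 else 0
    l = if a ≤ᵇ k then 1 else 0

  p-suc : ∀ k m → p (suc k) m ≡ m (suc k) + p k m
  p-suc k m = begin
    sum (List.map (m ∘ suc) (upTo (suc k)))                ≡⟨ cong (sum ∘ List.map (m ∘ suc)) (upTo-∷ʳ k) ⟨
    sum (List.map (m ∘ suc) (upTo k List.∷ʳ k))            ≡⟨ cong sum (map-++ (m ∘ suc) (upTo k) (k ∷ [])) ⟩
    sum (List.map (m ∘ suc) (upTo k) List.++ (m (suc k) ∷ [])) ≡⟨ sum-++ (List.map (m ∘ suc) (upTo k)) (m (suc k) ∷ []) ⟩
    p k m + (m (suc k) + 0)                                ≡⟨ cong (p k m +_) (+-identityʳ _) ⟩
    p k m + m (suc k)                                      ≡⟨ +-comm (p k m) _ ⟩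
    m (suc k) + p k m                                      ∎
    where open ≡-Reasoning

  p-monotone : ∀ m → Monotone (λ k → p k m)
  p-monotone m {j} {k} j≤k with o , refl ← m≤n⇒∃[o]m+o≡n j≤k = go o
    where
    go : ∀ o → p j m ≤ p (j + o) m
    go zero rewrite +-identityʳ j = ≤-refl
    go (suc o) rewrite +-suc j o | p-suc (j + o) m = ≤-trans (go o) (m≤n+m _ (m (suc (j + o))))

  p-cong : ∀ {m m'} → (∀ k → m (suc k) ≡ m' (suc k)) → ∀ k → p k m ≡ p k m'
  p-cong e zero = refl
  p-cong {m} {m'} e (suc k) rewrite p-suc k m | p-suc k m' = cong₂ _+_ (e k) (p-cong {m} {m'} e k)

  <ᵇ-true : ∀ {m n} → m < n → (m <ᵇ n) ≡ true
  <ᵇ-true = ≤ᵇ-true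

  <ᵇ-false : ∀ {m n} → n ≤ m → (m <ᵇ n) ≡ false
  <ᵇ-false = ≤ᵇ-false ∘ s≤s

  ≡ᵇ-refl : ∀ k → (k ≡ᵇ k) ≡ true
  ≡ᵇ-refl zero    = refl
  ≡ᵇ-refl (suc k) = ≡ᵇ-refl k

  ≡ᵇ-false : ∀ {k i} → i < k → (k ≡ᵇ i) ≡ false
  ≡ᵇ-false {suc k} {zero}  _       = refl
  ≡ᵇ-false {suc k} {suc i} (s≤s h) = ≡ᵇ-false h

  mergeType-< : ∀ m → k < i → mergeType i m k ≡ m k
  mergeType-< m k<i rewrite <ᵇ-true k<i = refl

  mergeType-≡ : ∀ i m → mergeType i m i ≡ m i + m (suc i)
  mergeType-≡ i m rewrite <ᵇ-false (≤-refl {i}) | ≡ᵇ-refl i = refl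

  mergeType-> : ∀ m → i < k → mergeType i m k ≡ m (suc k)
  mergeType-> m i<k rewrite <ᵇ-false (<⇒≤ i<k) | ≡ᵇ-false i<k = refl

  -- Entry `i` of the merged type absorbs `m (suc i)`, so its partial sum at `i` is already
  -- `p (suc i) m`. Merging a type deletes one partial sum, just as merging a word deletes one flag
  -- member.
  p-merge-skips : ∀ i m → 1 ≤ i → Skips i (λ k → p k m) (λ k → p k (mergeType i m))
  p-merge-skips (suc i) m _ = below , λ k i<k → above′ k (m≤n⇒∃[o]m+o≡n i<k)
    where
    open ≡-Reasoning
    m′ : Type
    m′ = mergeType (suc i) m
    below : ∀ k → k < suc i → p k m′ ≡ p k m
    below zero _ = refl
    below (suc k) k<i = begin
      p (suc k) m′       ≡⟨ p-suc k m′ ⟩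
      m′ (suc k) + p k m′ ≡⟨ cong₂ _+_ (mergeType-< m k<i) (below k (<-trans (n<1+n k) k<i)) ⟩
      m (suc k) + p k m  ≡⟨ p-suc k m ⟨
      p (suc k) m        ∎
    above : ∀ o → p (o + suc i) m′ ≡ p (suc (o + suc i)) m
    above zero = begin
      p (suc i) m′                            ≡⟨ p-suc i m′ ⟩
      m′ (suc i) + p i m′                     ≡⟨ cong₂ _+_ (trans (mergeType-≡ (suc i) m) (+-comm (m (suc i)) _)) (below i (n<1+n i)) ⟩
      m (suc (suc i)) + m (suc i) + p i m     ≡⟨ +-assoc (m (suc (suc i))) _ _ ⟩
      m (suc (suc i)) + (m (suc i) + p i m)   ≡⟨ cong (m (suc (suc i)) +_) (p-suc i m) ⟨
      m (suc (suc i)) + p (suc i) m           ≡⟨ p-suc (suc i) m ⟨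
      p (suc (suc i)) m                       ∎
    above (suc o) = begin
      p (suc o + suc i) m′                              ≡⟨ p-suc (o + suc i) m′ ⟩
      m′ (suc (o + suc i)) + p (o + suc i) m′           ≡⟨ cong₂ _+_ (mergeType-> m (s≤s (m≤n+m (suc i) o))) (above o) ⟩
      m (suc (suc o + suc i)) + p (suc (o + suc i)) m   ≡⟨ p-suc (suc o + suc i) m ⟨
      p (suc (suc o + suc i)) m                         ∎
    above′ : ∀ k → (∃ λ o → suc i + o ≡ k) → p k m′ ≡ p (suc k) m
    above′ k (o , refl) = subst (λ l → p l m′ ≡ p (suc l) m) (+-comm o (suc i)) (above o)

  allOnes-good : ∀ {sz} → sz 0 ≡ 0 → Good sz 1 (allOnes n)
  allOnes-good {n} e .size zero _ = trans (trans (cong ∣_∣ (map-replicate (_≤ᵇ 0) 1 n)) (∣⊥∣≡0 n)) (sym e)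
  allOnes-good e .size (suc k) (s≤s ())
  allOnes-good {n} e .full k 1≤k = S-full λ j → ≤-trans (≤-reflexive (lookup-replicate j 1)) 1≤k

  good-≥1 : ∀ {sz K} {w : Word n} → sz 0 ≡ 0 → 1 ≤ K → Good sz K w → IsWord w
  good-≥1 {w = w} e 1≤K g j = ≤ᵇ-false⁻ (trans (sym (lookup-S 0 w j)) (∣∣-empty (S 0 w) (trans (size g 0 1≤K) e) j))

  good-1 : ∀ {sz} {w : Word n} → sz 0 ≡ 0 → Good sz 1 w → w ≡ allOnes n
  good-1 {w = w} e g = lookup-ext λ j → trans (≤-antisym (good-≤ g j) (good-≥1 e ≤-refl g j)) (sym (lookup-replicate j 1))

  p-typeOf : (v : Word n) → IsWord v → ∀ k → p k (typeOf v) ≡ ∣ S k v ∣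
  p-typeOf {n} v pos zero = sym (trans (cong ∣_∣ S0) (∣⊥∣≡0 n))
    where
    S0 : S 0 v ≡ ⊥
    S0 = lookup-ext λ j → trans (lookup-S 0 v j) (trans (≤ᵇ-false (pos j)) (sym (lookup-replicate j false)))
  p-typeOf v pos (suc k) = trans (p-suc k (typeOf v)) (trans (cong (count (suc k) v +_) (p-typeOf v pos k)) (sym (∣S∣-suc k v)))

  ∣S∣⇒HasType : ∀ {m} {w : Word n} → (∀ k → ∣ S k w ∣ ≡ p k m) → HasType w m
  ∣S∣⇒HasType {m = m} {w} e (suc k) _ = +-cancelʳ-≡ (p k m) _ _ (begin
    count (suc k) w + p k m       ≡⟨ cong (count (suc k) w +_) (e k) ⟨
    count (suc k) w + ∣ S k w ∣   ≡⟨ ∣S∣-suc k w ⟨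
    ∣ S (suc k) w ∣               ≡⟨ e (suc k) ⟩
    p (suc k) m                   ≡⟨ p-suc k m ⟩
    m (suc k) + p k m             ∎)
    where open ≡-Reasoning

  lookup≤numClasses : (w : Word n) → ∀ j → lookup w j ≤ numClasses w
  lookup≤numClasses (a ∷ w) zero    = m≤m⊔n a _
  lookup≤numClasses (a ∷ w) (suc j) = ≤-trans (lookup≤numClasses w j) (m≤n⊔m a _)

  numClasses≤ : ∀ {K} (w : Word n) → (∀ j → lookup w j ≤ K) → numClasses w ≤ K
  numClasses≤ []      _ = z≤n
  numClasses≤ (a ∷ w) h = ⊔-lub (h zero) (numClasses≤ w (h ∘ suc))

  count≢0⇒≤numClasses : ∀ k (w : Word n) → count k w ≢ 0 → k ≤ numClasses w
  count≢0⇒≤numClasses k []      ne = contradiction refl ne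
  count≢0⇒≤numClasses k (a ∷ w) ne with a ≡ᵇ k in e
  ... | true  = ≤-trans (≤-reflexive (sym (≡ᵇ⇒≡ a k (subst T (sym e) _)))) (m≤m⊔n a _)
  ... | false = ≤-trans (count≢0⇒≤numClasses k w ne) (m≤n⊔m a _)

  merge-lookup-≤ : ∀ {K} (u : Word n) → i ≤ K → (∀ j → lookup (mergeWord i u) j ≤ K) ⇔ (∀ j → lookup u j ≤ suc K)
  merge-lookup-≤ {i = i} {K} u i≤K = mk⇔
    (λ h j → ≤ᵇ-true⁻ (trans (sym (at j)) (≤ᵇ-true (h j))))
    (λ h j → ≤ᵇ-true⁻ (trans (at j) (≤ᵇ-true (h j))))
    where
    at : ∀ j → (lookup (mergeWord i u) j ≤ᵇ K) ≡ (lookup u j ≤ᵇ suc K)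
    at j = trans (cong (_≤ᵇ K) (lookup-map j _ u)) (merge-≤ᵇ-≥ (lookup u j) i≤K)

  numClasses-merge : (u : Word n) → i ≤ numClasses (mergeWord i u) → i < numClasses u → numClasses u ≡ suc (numClasses (mergeWord i u))
  numClasses-merge {i = i} u i≤ i< = ≤-antisym
    (numClasses≤ u (Equivalence.to (merge-lookup-≤ u i≤) (lookup≤numClasses (mergeWord i u))))
    (lower (numClasses u) i< (lookup≤numClasses u))
    where
    lower : ∀ M → i < M → (∀ j → lookup u j ≤ M) → suc (numClasses (mergeWord i u)) ≤ M
    lower (suc M) (s≤s i≤M) h = s≤s (numClasses≤ (mergeWord i u) (Equivalence.from (merge-lookup-≤ u i≤M) h))

open Queues
open import Level using (Level)
open import Algebra.Bundles using (CommutativeSemiring)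
open import Data.Nat as ℕ using (ℕ; zero; suc; _≤_; _<_; z≤n; s≤s)
import Data.Nat.Properties as ℕ
open import Data.Bool using (true; false; if_then_else_)
open import Data.Fin using (Fin; zero; suc)
open import Data.Fin.Subset using (Subset; ∣_∣)
open import Data.Vec using ([]; _∷_; _∷ʳ_; reverse)
open import Data.Vec.Properties using (≡-dec; reverse-∷; reverse-involutive; reverse-injective; ∷-injectiveʳ)
open import Data.List using (List; []; _∷_; _++_; map; concatMap; cartesianProduct; applyUpTo)
open import Data.List.Properties using (map-∘; map-upTo; map-tabulate)
open import Data.List.Membership.Propositional using (_∈_; _∉_)
open import Data.List.Membership.Propositional.Properties using (∈-map⁺; ∈-map⁻; ∈-filter⁺; ∈-filter⁻; ∈-cartesianProduct⁺; ∈-cartesianProduct⁻)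
open import Data.List.Membership.Propositional.Properties.WithK using (unique∧set⇒bag)
open import Data.List.Relation.Binary.BagAndSetEquality using (∼bag⇒↭)
open import Data.List.Relation.Binary.Permutation.Propositional as ↭ using (_↭_)
open import Data.List.Relation.Unary.All as All using (All; []; _∷_)
import Data.List.Relation.Unary.All.Properties as All
open import Data.List.Relation.Unary.AllPairs using ([]; _∷_)
open import Data.List.Relation.Unary.Any using (here; there)
open import Data.List.Relation.Unary.Unique.Propositional using (Unique)
open import Data.List.Relation.Unary.Unique.Propositional.Properties using (cartesianProduct⁺; filter⁺)
open import Data.Product using (∃; _×_; _,_; proj₁; proj₂)
open import Function using (_∘_; _⇔_; mk⇔; Equivalence)
open import Relation.Binary.PropositionalEquality as ≡ using (_≡_; _≢_; refl; cong; cong₂; subst)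
open import Relation.Nullary using (does; yes; no)
open import Relation.Nullary.Decidable using (dec-true; dec-false)

-- The bijection on pairs of queues

∈-allSubsets : (s : Subset n) → s ∈ allSubsets n
∈-allSubsets [] = here refl
∈-allSubsets {suc n} (b ∷ s) = go b (∈-allSubsets s)
  where
  go : ∀ b {L} → s ∈ L → b ∷ s ∈ concatMap (λ s → (true ∷ s) ∷ (false ∷ s) ∷ []) L
  go true  (here refl) = here refl
  go false (here refl) = there (here refl)
  go b     (there s∈)  = there (there (go b s∈))

unique-allSubsets : ∀ n → Unique (allSubsets n)
unique-allSubsets zero = [] ∷ []
unique-allSubsets (suc n) = go (unique-allSubsets n)
  where
  apart : ∀ {s : Subset n} {L} b → All (s ≢_) L → All (b ∷ s ≢_) (concatMap (λ s → (true ∷ s) ∷ (false ∷ s) ∷ []) L)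
  apart b [] = []
  apart b (s≢ ∷ h) = s≢ ∘ ∷-injectiveʳ ∷ s≢ ∘ ∷-injectiveʳ ∷ apart b h
  go : ∀ {L : List (Subset n)} → Unique L → Unique (concatMap (λ s → (true ∷ s) ∷ (false ∷ s) ∷ []) L)
  go [] = []
  go (s∉ ∷ un) = ((λ ()) ∷ apart true s∉) ∷ apart false s∉ ∷ go un

∈-subsetsOfSize : {s : Subset n} → s ∈ subsetsOfSize n k ⇔ ∣ s ∣ ≡ k
∈-subsetsOfSize {n} {k} {s} = mk⇔ (proj₂ ∘ ∈-filter⁻ (λ s → ∣ s ∣ ℕ.≟ k) {xs = allSubsets n}) (∈-filter⁺ (λ s → ∣ s ∣ ℕ.≟ k) (∈-allSubsets s))

size∈ : {s : Subset n} → s ∈ subsetsOfSize n k → ∣ s ∣ ≡ k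
size∈ = Equivalence.to ∈-subsetsOfSize

unique-map : ∀ {A B : Set} (f : A → B) {L : List A} → (∀ {a b} → a ∈ L → b ∈ L → f a ≡ f b → a ≡ b) → Unique L → Unique (map f L)
unique-map f inj [] = []
unique-map f inj (a∉ ∷ un) =
  All.map⁺ (All.tabulate λ b∈ e → All.lookup a∉ b∈ (inj (here refl) (there b∈) e)) ∷ unique-map f (λ a∈ b∈ → inj (there a∈) (there b∈)) un

map-bijection-↭ : ∀ {A : Set} (f : A → A) {L : List A} → Unique L → (∀ {a} → a ∈ L → f a ∈ L) →
  (∀ {a b} → a ∈ L → b ∈ L → f a ≡ f b → a ≡ b) → (∀ {b} → b ∈ L → ∃ λ a → a ∈ L × f a ≡ b) → map f L ↭ L
map-bijection-↭ f un into inj surj = ∼bag⇒↭ (unique∧set⇒bag (unique-map f inj un) un (mk⇔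
  (λ b∈ → let a , a∈ , e = ∈-map⁻ f b∈ in subst (_∈ _) (≡.sym e) (into a∈))
  (λ b∈ → let a , a∈ , e = surj b∈ in subst (_∈ map f _) e (∈-map⁺ f a∈))))

∣∷ʳ∣ : ∀ (A : Subset n) a → ∣ A ∷ʳ a ∣ ≡ ∣ a ∷ A ∣
∣∷ʳ∣ [] a = refl
∣∷ʳ∣ (true ∷ A) true = cong suc (∣∷ʳ∣ A true)
∣∷ʳ∣ (true ∷ A) false = cong suc (∣∷ʳ∣ A false)
∣∷ʳ∣ (false ∷ A) true = ∣∷ʳ∣ A true
∣∷ʳ∣ (false ∷ A) false = ∣∷ʳ∣ A false

∣reverse∣ : (A : Subset n) → ∣ reverse A ∣ ≡ ∣ A ∣
∣reverse∣ [] = refl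
∣reverse∣ (a ∷ A) = ≡.trans (cong ∣_∣ (reverse-∷ a A)) (≡.trans (∣∷ʳ∣ (reverse A) a)
  (≡.trans (∣∷∣ a (reverse A)) (≡.trans (cong ((if a then 1 else 0) ℕ.+_) (∣reverse∣ A)) (≡.sym (∣∷∣ a A)))))

queue-reverse : Queue A B D R → Queue (reverse D) (reverse R) (reverse A) (reverse B)
queue-reverse (x , t) = x , run-reverse t

Pairs : ∀ n → ℕ → ℕ → List (Subset n × Subset n)
Pairs n a b = cartesianProduct (subsetsOfSize n a) (subsetsOfSize n b)

Pairs-size : ∀ {A B : Subset n} {a b} → (A , B) ∈ Pairs n a b ⇔ (∣ A ∣ ≡ a × ∣ B ∣ ≡ b)
Pairs-size {n} {a = a} {b} = mk⇔
  (λ h → let h₁ , h₂ = ∈-cartesianProduct⁻ (subsetsOfSize n a) (subsetsOfSize n b) h in size∈ h₁ , size∈ h₂)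
  (λ { (e₁ , e₂) → ∈-cartesianProduct⁺ (Equivalence.from ∈-subsetsOfSize e₁) (Equivalence.from ∈-subsetsOfSize e₂) })

Pairs-≤ : ∀ {A B : Subset n} {a b} → a ≤ b → (A , B) ∈ Pairs n a b → ∣ A ∣ ≤ ∣ B ∣
Pairs-≤ a≤b h with refl , refl ← Equivalence.to Pairs-size h = a≤b

-- For the time-reversed queue, uniqueness of its outputs gives injectivity and its existence gives
-- surjectivity. It exists because reversal preserves sizes and `(D, R)` has the sizes of `(A, B)`.
cyc-↭ : ∀ {n a b} → a ≤ b → map cyc (Pairs n a b) ↭ Pairs n a b
cyc-↭ {n} {a} {b} a≤b = map-bijection-↭ cyc
  (cartesianProduct⁺ (filter⁺ _ (unique-allSubsets n)) (filter⁺ _ (unique-allSubsets n))) into inj surj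
  where
  into : ∀ {c} → c ∈ Pairs n a b → cyc c ∈ Pairs n a b
  into {A , B} h = let e₁ , e₂ = Equivalence.to Pairs-size h ; Q = queue A B (Pairs-≤ a≤b h) in
    Equivalence.from Pairs-size (≡.trans (queue-served Q) e₁ , ≡.trans (queue-residue Q) e₂)
  inj : ∀ {c d} → c ∈ Pairs n a b → d ∈ Pairs n a b → cyc c ≡ cyc d → c ≡ d
  inj {A , B} {A' , B'} h h' e =
    let Q  = queue-reverse (queue A B (Pairs-≤ a≤b h))
        Q' = queue-reverse (queue A' B' (Pairs-≤ a≤b h'))
        e₁ , e₂ = Queue-functional Q (subst (λ c → Queue (reverse (proj₁ c)) (reverse (proj₂ c)) (reverse A') (reverse B')) (≡.sym e) Q')
    in cong₂ _,_ (reverse-injective e₁) (reverse-injective e₂)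
  surj : ∀ {d} → d ∈ Pairs n a b → ∃ λ c → c ∈ Pairs n a b × cyc c ≡ d
  surj {D , R} h =
    let e₁ , e₂ = Equivalence.to Pairs-size h
        Q = queue (reverse D) (reverse R) (≡.subst₂ _≤_ (≡.sym (∣reverse∣ D)) (≡.sym (∣reverse∣ R)) (Pairs-≤ a≤b h))
        A = reverse (proj₁ (cyc (reverse D , reverse R)))
        B = reverse (proj₂ (cyc (reverse D , reverse R)))
        Q' : Queue A B D R
        Q' = ≡.subst₂ (Queue A B) (reverse-involutive D) (reverse-involutive R) (queue-reverse Q)
        h' : (A , B) ∈ Pairs n a b
        h' = Equivalence.from Pairs-size (≡.trans (≡.sym (queue-served Q')) e₁ , ≡.trans (≡.sym (queue-residue Q')) e₂)
        f₁ , f₂ = Queue-functional (queue A B (Pairs-≤ a≤b h')) Q'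
    in (A , B) , h' , cong₂ _,_ f₁ f₂

-- Generating functions

module _ {c ℓ : Level} (CS : CommutativeSemiring c ℓ) where
  open CommutativeSemiring CS hiding (zero) renaming (refl to ≈-refl; sym to ≈-sym; trans to ≈-trans; reflexive to ≈-reflexive)
  open Poly CS
  open import Relation.Binary.Reasoning.Setoid setoid
  open import Algebra.Properties.CommutativeSemigroup +-commutativeSemigroup using () renaming (interchange to +-interchange)
  open import Algebra.Properties.CommutativeSemigroup *-commutativeSemigroup using () renaming (interchange to *-interchange)

  ∑ : ∀ {A : Set} → List A → (A → Carrier) → Carrier
  ∑ L h = sumR (map h L)

  ∑-cong : ∀ {A : Set} (L : List A) {h g : A → Carrier} → (∀ {a} → a ∈ L → h a ≈ g a) → ∑ L h ≈ ∑ L g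
  ∑-cong [] e = ≈-refl
  ∑-cong (a ∷ L) e = +-cong (e (here refl)) (∑-cong L (e ∘ there))

  ∑-++ : ∀ {A : Set} (L M : List A) (h : A → Carrier) → ∑ (L ++ M) h ≈ ∑ L h + ∑ M h
  ∑-++ [] M h = ≈-sym (+-identityˡ _)
  ∑-++ (a ∷ L) M h = ≈-trans (+-congˡ (∑-++ L M h)) (≈-sym (+-assoc _ _ _))

  ∑-map : ∀ {A B : Set} (f : A → B) (L : List A) (h : B → Carrier) → ∑ (map f L) h ≈ ∑ L (h ∘ f)
  ∑-map f L h = ≈-reflexive (cong sumR (≡.sym (map-∘ L)))

  ∑-concatMap : ∀ {A B : Set} (f : A → List B) (L : List A) (h : B → Carrier) → ∑ (concatMap f L) h ≈ ∑ L (λ a → ∑ (f a) h)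
  ∑-concatMap f [] h = ≈-refl
  ∑-concatMap f (a ∷ L) h = ≈-trans (∑-++ (f a) (concatMap f L) h) (+-congˡ (∑-concatMap f L h))

  ∑-cartesianProduct : ∀ {A B : Set} (L : List A) (M : List B) (h : A × B → Carrier) →
    ∑ (cartesianProduct L M) h ≈ ∑ L (λ a → ∑ M (λ b → h (a , b)))
  ∑-cartesianProduct [] M h = ≈-refl
  ∑-cartesianProduct (a ∷ L) M h = ≈-trans (∑-++ (map (a ,_) M) (cartesianProduct L M) h)
    (+-cong (∑-map (a ,_) M h) (∑-cartesianProduct L M h))

  ∑-zero : ∀ {A : Set} (L : List A) {h : A → Carrier} → (∀ {a} → a ∈ L → h a ≈ 0#) → ∑ L h ≈ 0#
  ∑-zero [] e = ≈-refl
  ∑-zero (a ∷ L) e = ≈-trans (+-cong (e (here refl)) (∑-zero L (e ∘ there))) (+-identityˡ 0#)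

  ∑-+ : ∀ {A : Set} (L : List A) (h g : A → Carrier) → ∑ L (λ a → h a + g a) ≈ ∑ L h + ∑ L g
  ∑-+ [] h g = ≈-sym (+-identityˡ 0#)
  ∑-+ (a ∷ L) h g = ≈-trans (+-congˡ (∑-+ L h g)) (+-interchange _ _ _ _)

  ∑-swap : ∀ {A B : Set} (L : List A) (M : List B) (h : A → B → Carrier) →
    ∑ L (λ a → ∑ M (h a)) ≈ ∑ M (λ b → ∑ L (λ a → h a b))
  ∑-swap [] M h = ≈-sym (∑-zero M (λ _ → ≈-refl))
  ∑-swap (a ∷ L) M h = ≈-trans (+-congˡ (∑-swap L M h)) (≈-sym (∑-+ M (h a) _))

  *-distribˡ-∑ : ∀ {A : Set} x (L : List A) (h : A → Carrier) → x * ∑ L h ≈ ∑ L (λ a → x * h a)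
  *-distribˡ-∑ x [] h = zeroʳ x
  *-distribˡ-∑ x (a ∷ L) h = ≈-trans (distribˡ x _ _) (+-congˡ (*-distribˡ-∑ x L h))

  *-distribʳ-∑ : ∀ {A : Set} x (L : List A) (h : A → Carrier) → ∑ L h * x ≈ ∑ L (λ a → h a * x)
  *-distribʳ-∑ x [] h = zeroˡ x
  *-distribʳ-∑ x (a ∷ L) h = ≈-trans (distribʳ x _ _) (+-congˡ (*-distribʳ-∑ x L h))

  ∑-↭ : ∀ {A : Set} {L M : List A} (h : A → Carrier) → L ↭ M → ∑ L h ≈ ∑ M h
  ∑-↭ h ↭.refl = ≈-refl
  ∑-↭ h (↭.prep a p) = +-congˡ (∑-↭ h p)
  ∑-↭ h (↭.swap a b p) = ≈-trans (≈-sym (+-assoc _ _ _)) (≈-trans (+-cong (+-comm _ _) (∑-↭ h p)) (+-assoc _ _ _))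
  ∑-↭ h (↭.trans p q) = ≈-trans (∑-↭ h p) (∑-↭ h q)

  δ : ∀ {n} → Word n → Word n → Carrier
  δ u w = if does (≡-dec ℕ._≟_ w u) then 1# else 0#

  δ-≡ : ∀ {n} {u w : Word n} → w ≡ u → δ u w ≈ 1#
  δ-≡ {u = u} {w} e rewrite dec-true (≡-dec ℕ._≟_ w u) e = ≈-refl

  δ-≢ : ∀ {n} {u w : Word n} → w ≢ u → δ u w ≈ 0#
  δ-≢ {u = u} {w} e rewrite dec-false (≡-dec ℕ._≟_ w u) e = ≈-refl

  ∑-δ-∉ : ∀ {n} (U : List (Word n)) {w} → w ∉ U → ∑ U (λ u → δ u w) ≈ 0#
  ∑-δ-∉ U {w} w∉ = ∑-zero U (λ {u} u∈ → δ-≢ {u = u} {w} (λ { refl → w∉ u∈ }))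

  ∑-δ-∈ : ∀ {n} (U : List (Word n)) {w} → Unique U → w ∈ U → ∑ U (λ u → δ u w) ≈ 1#
  ∑-δ-∈ (u ∷ U) (u∉ ∷ un) (here refl) =
    ≈-trans (+-cong (δ-≡ {u = u} refl) (∑-δ-∉ U (λ w∈ → All.lookup u∉ w∈ refl))) (+-identityʳ 1#)
  ∑-δ-∈ (u ∷ U) {w} (u∉ ∷ un) (there w∈) =
    ≈-trans (+-cong (δ-≢ {u = u} {w} (λ e → All.lookup u∉ w∈ (≡.sym e))) (∑-δ-∈ U un w∈)) (+-identityˡ 1#)

  monQ-∷ : ∀ {n} (x : Fin (suc n) → Carrier) a (A : Subset n) → monQ x (a ∷ A) ≈ (if a then x zero else 1#) * monQ (x ∘ suc) A
  monQ-∷ {n} x a A = *-congˡ (≈-reflexive (cong prodR (≡.trans (map-tabulate suc g) (≡.sym (map-tabulate (λ j → j) (g ∘ suc))))))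
    where
    g : Fin (suc n) → Carrier
    g j = if isIn (a ∷ A) j then x j else 1#

  step-weight : ∀ (y : Carrier) {x x' a b d r} → Step x a b x' d r →
    (if a then y else 1#) * (if b then y else 1#) ≈ (if d then y else 1#) * (if r then y else 1#)
  step-weight y idle = ≈-refl
  step-weight y wait = *-comm _ _
  step-weight y unused = ≈-refl
  step-weight y serve = *-comm _ _
  step-weight y pass = ≈-refl

  run-weight : ∀ {n} (x : Fin n → Carrier) {y z A B D R} → Run y A B z D R → monQ x A * monQ x B ≈ monQ x D * monQ x R
  run-weight x [] = ≈-refl
  run-weight x (_∷_ {a = a} {b = b} {d = d} {r = r} {A = A} {B = B} {D = D} {R = R} s t) = begin
    monQ x (a ∷ A) * monQ x (b ∷ B)   ≈⟨ *-cong (monQ-∷ x a A) (monQ-∷ x b B) ⟩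
    _                                 ≈⟨ *-interchange _ _ _ _ ⟩
    _                                 ≈⟨ *-cong (step-weight (x zero) s) (run-weight (x ∘ suc) t) ⟩
    _                                 ≈⟨ *-interchange _ _ _ _ ⟩
    _                                 ≈⟨ *-cong (monQ-∷ x d D) (monQ-∷ x r R) ⟨
    monQ x (d ∷ D) * monQ x (r ∷ R)   ∎

  -- Sums over sequences of queues

  module _ {n : ℕ} (x : Fin n → Carrier) where

    -- The sum over all (q_K, …, q_{K+c-1}) with ∣q_k∣ = sz k of the weight times H of the image of w.
    T : (ℕ → ℕ) → ℕ → ℕ → Word n → (Word n → Carrier) → Carrier
    T sz K zero    w H = H w
    T sz K (suc c) w H = ∑ (subsetsOfSize n (sz K)) λ q → monQ x q * T sz (suc K) c (applyQueue q w) H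

    act : ∀ {sz K} {w : Word n} → Monotone sz → Good sz K w → ∀ {q} → q ∈ subsetsOfSize n (sz K) → Good sz (suc K) (applyQueue q w)
    act mono g {q} q∈ = Act.act-good g q (λ k k<K → ℕ.≤-trans (mono (ℕ.<⇒≤ k<K)) (ℕ.≤-reflexive (≡.sym (size∈ q∈)))) (size∈ q∈)

    T-cong : ∀ {sz K H H'} c {w} → Monotone sz → Good sz K w → (∀ w' → Good sz (c ℕ.+ K) w' → H w' ≈ H' w') → T sz K c w H ≈ T sz K c w H'
    T-cong zero mono g e = e _ g
    T-cong {sz} {K} (suc c) mono g e = ∑-cong (subsetsOfSize n (sz K)) λ q∈ → *-congˡ
      (T-cong c mono (act mono g q∈) (λ w' g' → e w' (subst (λ k → Good sz k w') (ℕ.+-suc c K) g')))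

    T-split : ∀ {sz K H} c d {w} → T sz K (c ℕ.+ d) w H ≈ T sz K c w (λ w' → T sz (c ℕ.+ K) d w' H)
    T-split zero d = ≈-refl
    T-split {sz} {K} {H} (suc c) d {w} = ∑-cong (subsetsOfSize n (sz K)) λ {q} q∈ → *-congˡ
      (≈-trans (T-split c d) (≈-reflexive (cong (λ k → T sz (suc K) c (applyQueue q w) (λ w' → T sz k d w' H)) (ℕ.+-suc c K))))

    T-sizes : ∀ {sz sz' K H} c {w} → (∀ k → k < c ℕ.+ K → sz k ≡ sz' k) → T sz K c w H ≈ T sz' K c w H
    T-sizes zero e = ≈-refl
    T-sizes {sz} {sz'} {K} (suc c) e rewrite e K (s≤s (ℕ.m≤n+m K c)) = ∑-cong (subsetsOfSize n (sz' K)) λ q∈ → *-congˡ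
      (T-sizes c (λ k k< → e k (subst (k <_) (ℕ.+-suc c K) k<)))

    T-∑ : ∀ {A : Set} {sz K} c {w} (L : List A) (H : A → Word n → Carrier) →
      ∑ L (λ a → T sz K c w (H a)) ≈ T sz K c w (λ w' → ∑ L (λ a → H a w'))
    T-∑ zero L H = ≈-refl
    T-∑ {sz = sz} {K} (suc c) L H = ≈-trans (∑-swap L (subsetsOfSize n (sz K)) _)
      (∑-cong (subsetsOfSize n (sz K)) λ {q} q∈ → ≈-trans (≈-sym (*-distribˡ-∑ (monQ x q) L _)) (*-congˡ (T-∑ c L H)))

    -- All remaining queues create members above the `i`-th, so the merge is pulled through them one
    -- by one. Their indices drop by one, which turns `sz` into `sz'`.
    T-merge : ∀ {i sz sz' K H} c {w} → Monotone sz → Skips i sz sz' → i ≤ K → Good sz (suc K) w →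
      T sz (suc K) c w (H ∘ mergeWord i) ≈ T sz' K c (mergeWord i w) H
    T-merge zero mono sk i≤K g = ≈-refl
    T-merge {i} {sz} {sz'} {K} {H} (suc c) {w} mono sk i≤K g rewrite proj₂ sk K i≤K = ∑-cong (subsetsOfSize n (sz (suc K))) λ {q} q∈ → *-congˡ (≈-trans
      (T-merge c mono sk (ℕ.m≤n⇒m≤1+n i≤K) (act mono g q∈))
      (≈-reflexive (cong (λ v → T sz' (suc K) c v H)
        (merge-applyQueue sk i≤K g q (λ k k<K → ℕ.≤-trans (mono (ℕ.<⇒≤ k<K)) (ℕ.≤-reflexive (≡.sym (size∈ q∈))))))))

    -- The change of variables `(A, B) ↦ (D, R)` in a double sum. `R` ends up outermost because
    -- after the interchange the larger queue acts before the smaller one.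
    pair-sum : ∀ {a b} → a ≤ b → (Φ Ψ : Subset n → Subset n → Carrier) →
      (∀ {A B D R} → ∣ A ∣ ≡ a → ∣ B ∣ ≡ b → Queue A B D R → Φ A B ≈ Ψ R D) →
      ∑ (subsetsOfSize n a) (λ A → monQ x A * ∑ (subsetsOfSize n b) (λ B → monQ x B * Φ A B)) ≈
      ∑ (subsetsOfSize n b) (λ R → monQ x R * ∑ (subsetsOfSize n a) (λ D → monQ x D * Ψ R D))
    pair-sum {a} {b} a≤b Φ Ψ e = begin
      ∑ (subsetsOfSize n a) (λ A → monQ x A * ∑ (subsetsOfSize n b) (λ B → monQ x B * Φ A B))
        ≈⟨ flatten (subsetsOfSize n a) (subsetsOfSize n b) Φ ⟩
      ∑ (subsetsOfSize n a) (λ A → ∑ (subsetsOfSize n b) (λ B → f (A , B)))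
        ≈⟨ ∑-cartesianProduct (subsetsOfSize n a) (subsetsOfSize n b) f ⟨
      ∑ (Pairs n a b) f
        ≈⟨ ∑-cong (Pairs n a b) moved ⟩
      ∑ (Pairs n a b) (g ∘ cyc)
        ≈⟨ ∑-map cyc (Pairs n a b) g ⟨
      ∑ (map cyc (Pairs n a b)) g
        ≈⟨ ∑-↭ g (cyc-↭ a≤b) ⟩
      ∑ (Pairs n a b) g
        ≈⟨ ∑-cartesianProduct (subsetsOfSize n a) (subsetsOfSize n b) g ⟩
      ∑ (subsetsOfSize n a) (λ D → ∑ (subsetsOfSize n b) (λ R → g (D , R)))
        ≈⟨ ∑-swap (subsetsOfSize n a) (subsetsOfSize n b) (λ D R → g (D , R)) ⟩
      ∑ (subsetsOfSize n b) (λ R → ∑ (subsetsOfSize n a) (λ D → g (D , R)))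
        ≈⟨ flatten (subsetsOfSize n b) (subsetsOfSize n a) Ψ ⟨
      ∑ (subsetsOfSize n b) (λ R → monQ x R * ∑ (subsetsOfSize n a) (λ D → monQ x D * Ψ R D)) ∎
      where
      f g : Subset n × Subset n → Carrier
      f (A , B) = (monQ x A * monQ x B) * Φ A B
      g (D , R) = (monQ x R * monQ x D) * Ψ R D
      flatten : ∀ L M (Φ : Subset n → Subset n → Carrier) →
        ∑ L (λ A → monQ x A * ∑ M (λ B → monQ x B * Φ A B)) ≈ ∑ L (λ A → ∑ M (λ B → (monQ x A * monQ x B) * Φ A B))
      flatten L M Φ = ∑-cong L λ {A} _ → ≈-trans (*-distribˡ-∑ (monQ x A) M _) (∑-cong M λ _ → ≈-sym (*-assoc _ _ _))
      moved : ∀ {c} → c ∈ Pairs n a b → f c ≈ g (cyc c)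
      moved {A , B} h = let e₁ , e₂ = Equivalence.to Pairs-size h ; Q = queue A B (Pairs-≤ a≤b h) in
        *-cong (≈-trans (run-weight x (proj₂ Q)) (*-comm _ _)) (e e₁ e₂ Q)

    -- Induction on the number of smaller queues: the `r`-queue is moved past all but the first of
    -- them, then past that one by `pair-sum` and `merge-interchange`. The merge index decreases
    -- along the way because it always refers to the member created by the `r`-queue.
    T-interchange : ∀ {sz K r} c {w} → Monotone sz → Good sz K w → (∀ k → k < c ℕ.+ K → sz k ≤ r) → (G : Word n → Carrier) →
      T sz K c w (λ w' → ∑ (subsetsOfSize n r) λ q → monQ x q * G (mergeWord (c ℕ.+ K) (applyQueue q w'))) ≈
      ∑ (subsetsOfSize n r) (λ q → monQ x q * T sz K c (mergeWord K (applyQueue q w)) G)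
    T-interchange zero mono g le G = ≈-refl
    T-interchange {sz} {K} {r} (suc c) {w} mono g le G = begin
      ∑ (subsetsOfSize n (sz K)) (λ q' → monQ x q' * T sz (suc K) c (applyQueue q' w)
          (λ w' → ∑ (subsetsOfSize n r) λ q → monQ x q * G (mergeWord (suc (c ℕ.+ K)) (applyQueue q w'))))
        ≈⟨ ∑-cong (subsetsOfSize n (sz K)) (λ {q'} q'∈ → *-congˡ (≈-trans
            (≈-reflexive (cong (λ k → T sz (suc K) c (applyQueue q' w)
              (λ w' → ∑ (subsetsOfSize n r) λ q → monQ x q * G (mergeWord k (applyQueue q w')))) (≡.sym (ℕ.+-suc c K))))
            (T-interchange c mono (act mono g q'∈) (λ k k< → le k (subst (k <_) (ℕ.+-suc c K) k<)) G))) ⟩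
      ∑ (subsetsOfSize n (sz K)) (λ q' → monQ x q' * ∑ (subsetsOfSize n r) (λ q →
          monQ x q * T sz (suc K) c (mergeWord (suc K) (applyQueue q (applyQueue q' w))) G))
        ≈⟨ pair-sum sz≤r _ _ (λ { e' refl Q → ≈-reflexive (cong (λ v → T sz (suc K) c v G) (merge-interchange mono g e' sz≤r Q)) }) ⟩
      ∑ (subsetsOfSize n r) (λ q → monQ x q * ∑ (subsetsOfSize n (sz K)) (λ q' →
          monQ x q' * T sz (suc K) c (applyQueue q' (mergeWord K (applyQueue q w))) G)) ∎
      where
      sz≤r : sz K ≤ r
      sz≤r = le K (s≤s (ℕ.m≤n+m K c))

    mlqs-T : ∀ {sz K} (u : Word n) c (f : ℕ → ℕ) w → (∀ t → f t ≡ sz (t ℕ.+ K)) →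
      ∑ (mlqsOfSizes n (applyUpTo f c)) (λ qs → if does (≡-dec ℕ._≟_ (applyMLQ qs w) u) then wt x qs else 0#) ≈ T sz K c w (δ u)
    mlqs-T u zero f w e = +-identityʳ _
    mlqs-T {sz} {K} u (suc c) f w e rewrite e 0 = ≈-trans
      (∑-concatMap (λ q → map (q ∷_) (mlqsOfSizes n (applyUpTo (f ∘ suc) c))) (subsetsOfSize n (sz K)) _)
      (∑-cong (subsetsOfSize n (sz K)) λ {q} _ → begin
        ∑ (map (q ∷_) L) h
          ≈⟨ ∑-map (q ∷_) L h ⟩
        ∑ L (h ∘ (q ∷_))
          ≈⟨ ∑-cong L (λ {qs} _ → factor (does (≡-dec ℕ._≟_ (applyMLQ qs (applyQueue q w)) u))) ⟩
        ∑ L (λ qs → monQ x q * (if does (≡-dec ℕ._≟_ (applyMLQ qs (applyQueue q w)) u) then wt x qs else 0#))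
          ≈⟨ *-distribˡ-∑ (monQ x q) L _ ⟨
        monQ x q * ∑ L (λ qs → if does (≡-dec ℕ._≟_ (applyMLQ qs (applyQueue q w)) u) then wt x qs else 0#)
          ≈⟨ *-congˡ (mlqs-T u c (f ∘ suc) (applyQueue q w) (λ t → ≡.trans (e (suc t)) (cong sz (≡.sym (ℕ.+-suc t K))))) ⟩
        monQ x q * T sz (suc K) c (applyQueue q w) (δ u) ∎)
      where
      L = mlqsOfSizes n (applyUpTo (f ∘ suc) c)
      h : List (Subset n) → Carrier
      h qs = if does (≡-dec ℕ._≟_ (applyMLQ qs w) u) then wt x qs else 0#
      factor : ∀ b {y z} → (if b then y * z else 0#) ≈ y * (if b then z else 0#)
      factor true = ≈-refl
      factor false = ≈-sym (zeroʳ _)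

    sw-T : ∀ {m} (u : Word n) → (∀ k → typeOf u (suc k) ≡ m (suc k)) → sw x u ≈ T (λ k → p k m) 1 (numClasses u ℕ.∸ 1) (allOnes n) (δ u)
    sw-T {m} u e = ≈-trans
      (≈-reflexive (cong (λ ss → ∑ (mlqsOfSizes n ss) (λ qs → if does (≡-dec ℕ._≟_ (applyMLQ qs (allOnes n)) u) then wt x qs else 0#))
        (map-upTo (λ t → p (suc t) (typeOf u)) (numClasses u ℕ.∸ 1))))
      (mlqs-T u (numClasses u ℕ.∸ 1) _ (allOnes n)
        (λ t → ≡.trans (p-cong {typeOf u} {m} e (suc t)) (cong (λ k → p k m) (ℕ.+-comm 1 t))))

-- The merging identity for spectral weights

theorem3p5 : {c ℓ : Level} (R : CommutativeSemiring c ℓ) →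
    let open CommutativeSemiring R
        open Poly R
    in (n : ℕ) → 1 ≤ n →
       (m : Type) (i : ℕ) → 1 ≤ i → m i ≢ 0 → m (suc i) ≢ 0 →
       (v : Word n) → Packed v → HasType v (mergeType i m) →
       (x : Fin n → Carrier) →
       (U : List (Word n)) → Unique U →
       ((u : Word n) → (u ∈ U) ⇔ (IsWord u × HasType u m × mergeWord i u ≡ v)) →
       (sw x v * elem x (p i m)) ≈ sumR (map (sw x) U)
theorem3p5 CS n _ m i 1≤i mi≢0 mi+1≢0 v (v-pos , _) v-type x U U-unique U-spec = begin
  sw x v * elem x ρ
    ≈⟨ *-comm _ _ ⟩
  elem x ρ * sw x v
    ≈⟨ *-congˡ (sw-T CS x {mergeType i m} v (λ k → v-type (suc k) (s≤s z≤n))) ⟩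
  elem x ρ * T′ sz' 1 (numClasses v ℕ.∸ 1) (allOnes n) (δ CS v)
    ≈⟨ *-congˡ (≈-reflexive (cong (λ c → T′ sz' 1 c (allOnes n) (δ CS v)) v-length)) ⟩
  elem x ρ * T′ sz' 1 (i₀ ℕ.+ e) (allOnes n) (δ CS v)
    ≈⟨ *-congˡ (T-split CS x i₀ e) ⟩
  elem x ρ * T′ sz' 1 i₀ (allOnes n) G
    ≈⟨ *-congˡ (T-sizes CS x i₀ (λ k k< → proj₁ skips k (subst (k <_) i₀+1≡i k<))) ⟩
  elem x ρ * T′ sz 1 i₀ (allOnes n) G
    ≈⟨ *-distribʳ-∑ CS _ (subsetsOfSize n ρ) (monQ x) ⟩
  ∑ CS (subsetsOfSize n ρ) (λ q → monQ x q * T′ sz 1 i₀ (allOnes n) G)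
    -- The factor `elem x ρ` becomes a genuine queue acting first, whose only effect on the word is
    -- forgotten at once.
    ≈⟨ ∑-cong CS (subsetsOfSize n ρ) (λ {q} _ → *-congˡ (≈-reflexive (cong (λ w → T′ sz 1 i₀ w G) (≡.sym (collapse q))))) ⟩
  ∑ CS (subsetsOfSize n ρ) (λ q → monQ x q * T′ sz 1 i₀ (mergeWord 1 (applyQueue q (allOnes n))) G)
    ≈⟨ T-interchange CS x i₀ mono ones (λ k k< → mono (ℕ.<⇒≤ (subst (k <_) i₀+1≡i k<))) G ⟨
  T′ sz 1 i₀ (allOnes n) (λ w → ∑ CS (subsetsOfSize n ρ) (λ q → monQ x q * G (mergeWord (i₀ ℕ.+ 1) (applyQueue q w))))
    ≈⟨ T-cong CS x i₀ mono ones inner ⟩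
  T′ sz 1 i₀ (allOnes n) (λ w → T′ sz (i₀ ℕ.+ 1) (suc e) w (δ CS v ∘ mergeWord i))
    ≈⟨ T-split CS x i₀ (suc e) ⟨
  T′ sz 1 (i₀ ℕ.+ suc e) (allOnes n) (δ CS v ∘ mergeWord i)
    ≈⟨ ≈-reflexive (cong (λ c → T′ sz 1 c (allOnes n) (δ CS v ∘ mergeWord i)) ℓ-split) ⟨
  T′ sz 1 L (allOnes n) (δ CS v ∘ mergeWord i)
    ≈⟨ T-cong CS x L mono ones (λ w g → ≈-sym (δ-sum (subst (λ k → Good sz k w) (ℕ.+-comm L 1) g))) ⟩
  T′ sz 1 L (allOnes n) (λ w → ∑ CS U (λ u → δ CS u w))
    ≈⟨ T-∑ CS x L U (δ CS) ⟨
  ∑ CS U (λ u → T′ sz 1 L (allOnes n) (δ CS u))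
    ≈⟨ ∑-cong CS U (λ {u} u∈ → ≈-trans
         (sw-T CS x {m} u (λ k → proj₁ (proj₂ (Equivalence.to (U-spec u) u∈)) (suc k) (s≤s z≤n)))
         (≈-reflexive (cong (λ c → T′ sz 1 (c ℕ.∸ 1) (allOnes n) (δ CS u)) (u-classes u∈)))) ⟨
  sumR (map (sw x) U) ∎
  where
  open CommutativeSemiring CS using (Carrier; _≈_; _*_; setoid; *-comm; *-congˡ) renaming (sym to ≈-sym; trans to ≈-trans; reflexive to ≈-reflexive)
  open Poly CS
  open import Relation.Binary.Reasoning.Setoid setoid

  T′ = T CS x

  i₀ L ρ : ℕ
  i₀ = i ℕ.∸ 1
  L  = numClasses v
  ρ  = p i m

  i₀+1≡i : i₀ ℕ.+ 1 ≡ i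
  i₀+1≡i = ℕ.m∸n+n≡m 1≤i

  sz sz' : ℕ → ℕ
  sz  k = p k m
  sz' k = p k (mergeType i m)

  mono : Monotone sz
  mono = p-monotone m

  skips : Skips i sz sz'
  skips = p-merge-skips i m 1≤i

  ones : Good sz 1 (allOnes n)
  ones = allOnes-good refl

  i≤L : i ≤ L
  i≤L = count≢0⇒≤numClasses i v (λ e → mi≢0 (ℕ.m+n≡0⇒m≡0 (m i) (≡.trans (≡.sym (mergeType-≡ i m)) (≡.trans (≡.sym (v-type i 1≤i)) e))))

  e : ℕ
  e = L ℕ.∸ i

  ℓ-split : L ≡ i₀ ℕ.+ suc e
  ℓ-split = ≡.trans (≡.sym (ℕ.m+[n∸m]≡n i≤L)) (≡.trans (cong (ℕ._+ e) (≡.sym i₀+1≡i)) (ℕ.+-assoc i₀ 1 e))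

  v-length : L ℕ.∸ 1 ≡ i₀ ℕ.+ e
  v-length = ≡.trans (cong (ℕ._∸ 1) ℓ-split) (cong (ℕ._∸ 1) (ℕ.+-suc i₀ e))

  G : Word n → Carrier
  G w = T′ sz' (i₀ ℕ.+ 1) e w (δ CS v)

  -- Merging at `1` forgets the member created by `q`, after which a single class remains.
  collapse : ∀ q → mergeWord 1 (applyQueue q (allOnes n)) ≡ allOnes n
  collapse q = good-1 refl (Act.merge-top-good ones q (λ { zero _ → z≤n ; (suc _) (s≤s ()) }))

  inner : ∀ w → Good sz (i₀ ℕ.+ 1) w →
    ∑ CS (subsetsOfSize n ρ) (λ q → monQ x q * G (mergeWord (i₀ ℕ.+ 1) (applyQueue q w))) ≈
    T′ sz (i₀ ℕ.+ 1) (suc e) w (δ CS v ∘ mergeWord i)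
  inner w g rewrite i₀+1≡i = ∑-cong CS (subsetsOfSize n ρ) λ q∈ → *-congˡ
    (≈-sym (T-merge CS x e mono skips ℕ.≤-refl (act CS x mono g q∈)))

  -- Since `m (suc i) ≢ 0`, the letter `suc i` occurs in `u`, so merging lowers the maximal letter
  -- by exactly one even when `suc i` is that letter. All `u` in `U` thus have MLQs of the same
  -- length.
  u-classes : ∀ {u} → u ∈ U → numClasses u ≡ suc L
  u-classes {u} u∈ with _ , u-type , refl ← Equivalence.to (U-spec u) u∈ =
    numClasses-merge u i≤L (count≢0⇒≤numClasses (suc i) u (λ e → mi+1≢0 (≡.trans (≡.sym (u-type (suc i) (s≤s z≤n))) e)))

  sizes : ∀ {w} → Good sz (suc L) w → ∀ k → ∣ S k w ∣ ≡ sz k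
  sizes {w} g k with k ℕ.<? suc L
  ... | yes k< = Good.size g k k<
  ... | no k≮ = top k (ℕ.≮⇒≥ k≮)
    where
    -- Here the member is full and `p k m` must be shown to be `n`. This is read off from `v`: it
    -- has the merged type, no letter above `L`, and its partial sums are those of `m` shifted by
    -- one.
    top : ∀ k → suc L ≤ k → ∣ S k w ∣ ≡ sz k
    top (suc k) (s≤s L≤k) = ≡.trans (cong ∣_∣ (Good.full g (suc k) (s≤s L≤k)))
      (≡.trans (cong ∣_∣ (≡.sym (S-full {w = v} (λ j → ℕ.≤-trans (lookup≤numClasses v j) L≤k))))
      (≡.trans (≡.sym (p-typeOf v v-pos k))
      (≡.trans (p-cong {typeOf v} {mergeType i m} (λ k → v-type (suc k) (s≤s z≤n)) k) (proj₂ skips k (ℕ.≤-trans i≤L L≤k)))))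

  -- The sizes of its flag already force `w` to be a word of type `m`, so `w` lies in `U` exactly
  -- when it merges to `v`, and then it occurs once.
  δ-sum : ∀ {w} → Good sz (suc L) w → ∑ CS U (λ u → δ CS u w) ≈ δ CS v (mergeWord i w)
  δ-sum {w} g with ≡-dec ℕ._≟_ (mergeWord i w) v
  ... | yes e = ∑-δ-∈ CS U U-unique (Equivalence.from (U-spec w)
    (good-≥1 refl (s≤s z≤n) g , ∣S∣⇒HasType {w = w} (sizes g) , e))
  ... | no ne = ∑-δ-∉ CS U (λ w∈ → ne (proj₂ (proj₂ (Equivalence.to (U-spec w) w∈))))
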